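{- Let $\delta$ be a positive integer, let $$p_\delta(x)=\left(\frac{1+\sqrt{1-4x}}{2}\right)^{\delta+1}+\left(\frac{1-\sqrt{1-4x}}{2}\right)^{\delta+1}$$ (a polynomial in $x$), let $d=\deg p_\delta$ and let $\vartheta_1,\dots,\vartheta_d$ be the roots of $p_\delta$. Then for every positive integer $m$, $$\zeta(m,\delta)=\frac{1}{\delta+1}\sum_{i=1}^{d}\left(\frac{1}{\vartheta_i}\right)^{\lfloor (m+1)/2\rfloor}.$$
   Context: For positive integers $m$ and $\delta$, a $\delta$-deviation set of size $m$ is a finite sequence $(\alpha_1,\dots,\alpha_\ell)$ of positive integers such that (i) $\sum_i\alpha_i=m$; (ii) $\big|\sum_i\alpha_{2i-1}-\sum_i\alpha_{2i}\big|\le 1$; (iii) $\big|\sum_{1\le i\le j}(-1)^{i-1}\alpha_i\big|\le\delta$ for every $j\ge1$; and $\zeta(m,\delta)$ is the number of $\delta$-deviation sets of size $m$. -}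

module Defs where

open import Algebra.Apartness.Bundles using (HeytingField; HeytingCommutativeRing)
open import Algebra.Bundles using (CommutativeRing; RawRing)
import Algebra.Definitions.RawSemiring as RawSemiringDefinitions
import Algebra.Properties.CommutativeSemigroup as CommutativeSemigroupProperties
import Algebra.Properties.Ring as RingProperties
open import Data.Empty using (⊥)
open import Data.Fin.Base using (Fin; zero; suc; toℕ; fromℕ<)
import Data.Fin.Properties as Fin
import Data.Integer.Base as ℤ
open import Data.List.Base using (List; []; _∷_; _++_; map; filter; length; take)
open import Data.List.Properties using (take-all; ∷-injectiveʳ)
open import Data.List.Membership.Propositional using (_∈_)
open import Data.List.Membership.Propositional.Properties
  using (∈-map⁺; ∈-map⁻; ∈-++⁺ˡ; ∈-++⁺ʳ; ∈-++⁻; ∈-filter⁺; ∈-filter⁻)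
open import Data.List.Relation.Unary.All as All using (All; []; _∷_)
import Data.List.Relation.Unary.All.Properties as All
open import Data.List.Relation.Unary.Any using (here; there)
open import Data.List.Relation.Unary.AllPairs using ([]; _∷_)
open import Data.List.Relation.Unary.Unique.Propositional using (Unique)
import Data.List.Relation.Unary.Unique.Propositional.Properties as Unique
open import Data.Nat.Base
  using (ℕ; zero; suc; _+_; _≤_; _<_; z≤n; s≤s; NonZero; ∣_-_∣)
open import Data.Nat.ListAction using (sum)
open import Data.Nat.Properties
  using (_≟_; _≤?_; nonZero?; suc-injective; ≰⇒≥; ≤-refl)
open import Data.Product.Base using (∃; _×_; _,_; proj₁; proj₂)
open import Data.Sum.Base using (inj₁; inj₂)
open import Data.Vec.Functional using (Vector)
open import Function.Bundles using (_⇔_; mk⇔)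
open import Level using (Level; _⊔_)
open import Relation.Binary.PropositionalEquality
  using (_≡_; refl; sym; trans; subst)
import Relation.Binary.Reasoning.Setoid as SetoidReasoning
open import Relation.Nullary.Decidable using (Dec; yes; no; map′; _×-dec_)

private variable
  c ℓ ℓ₁ ℓ₂ : Level

oddSum evenSum : List ℕ → ℕ
oddSum []       = 0
oddSum (a ∷ α)  = a + evenSum α
evenSum []      = 0
evenSum (_ ∷ α) = oddSum α

-- Σᵢ (-1)^(i-1) αᵢ
altSum : List ℕ → ℤ.ℤ
altSum []      = ℤ.0ℤ
altSum (a ∷ α) = ℤ.+ a ℤ.- altSum α

record IsDeviationSet (m δ : ℕ) (α : List ℕ) : Set where
  field
    positive : All NonZero α
    size     : sum α ≡ m
    balanced : ∣ oddSum α - evenSum α ∣ ≤ 1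
    bounded  : ∀ j → 1 ≤ j → ℤ.∣ altSum (take j α) ∣ ≤ δ

incHead : List ℕ → List ℕ
incHead []      = []
incHead (a ∷ α) = suc a ∷ α

compositions : ℕ → List (List ℕ)
compositions 0             = [] ∷ []
compositions 1             = (1 ∷ []) ∷ []
compositions (suc (suc n)) =
  map (1 ∷_) (compositions (suc n)) ++ map incHead (compositions (suc n))

private
  bounded? : ∀ δ α → Dec (∀ j → 1 ≤ j → ℤ.∣ altSum (take j α) ∣ ≤ δ)
  bounded? δ α = map′ to from (Fin.all? (λ j → ℤ.∣ altSum (take (toℕ j) α) ∣ ≤? δ))
    where
    Bounded : ℕ → Set
    Bounded j = ℤ.∣ altSum (take j α) ∣ ≤ δ

    upTo : (∀ (j : Fin (suc (length α))) → Bounded (toℕ j)) → ∀ j → j ≤ length α → Bounded j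
    upTo h j j≤ = subst Bounded (Fin.toℕ-fromℕ< (s≤s j≤)) (h (fromℕ< (s≤s j≤)))

    to : (∀ (j : Fin (suc (length α))) → Bounded (toℕ j)) → ∀ j → 1 ≤ j → Bounded j
    to h j _ with j ≤? length α
    ... | yes j≤ = upTo h j j≤
    ... | no  j≰ = subst (λ β → ℤ.∣ altSum β ∣ ≤ δ)
                     (trans (take-all (length α) α ≤-refl) (sym (take-all j α (≰⇒≥ j≰))))
                     (upTo h (length α) ≤-refl)

    from : (∀ j → 1 ≤ j → Bounded j) → ∀ (j : Fin (suc (length α))) → Bounded (toℕ j)
    from h zero    = z≤n
    from h (suc j) = h (suc (toℕ j)) (s≤s z≤n)

  deviationSet? : ∀ m δ α → Dec (IsDeviationSet m δ α)
  deviationSet? m δ α = map′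
    (λ (p , s , b , d) → record { positive = p ; size = s ; balanced = b ; bounded = d })
    (λ h → let open IsDeviationSet h in positive , size , balanced , bounded)
    (All.all? nonZero? α ×-dec sum α ≟ m
      ×-dec ∣ oddSum α - evenSum α ∣ ≤? 1 ×-dec bounded? δ α)

  compositions-positive : ∀ n → All (All NonZero) (compositions n)
  compositions-positive 0             = [] ∷ []
  compositions-positive 1             = (_ ∷ []) ∷ []
  compositions-positive (suc (suc n)) = All.++⁺
    (All.map⁺ (All.map (_ ∷_) (compositions-positive (suc n))))
    (All.map⁺ (All.map incHead⁺ (compositions-positive (suc n))))
    where
    incHead⁺ : ∀ {β} → All NonZero β → All NonZero (incHead β)
    incHead⁺ []       = []
    incHead⁺ (_ ∷ ps) = _ ∷ ps

  compositions-complete : ∀ n {α} → All NonZero α → sum α ≡ n → α ∈ compositions n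
  compositions-complete 0 [] refl = here refl
  compositions-complete (suc n) [] ()
  compositions-complete 0 {suc _ ∷ _} (_ ∷ _) ()
  compositions-complete 1 {1 ∷ []} (_ ∷ _) refl = here refl
  compositions-complete 1 {1 ∷ suc _ ∷ _} (_ ∷ _) ()
  compositions-complete 1 {1 ∷ 0 ∷ _} (_ ∷ () ∷ _) _
  compositions-complete 1 {suc (suc _) ∷ _} (_ ∷ _) ()
  compositions-complete (suc (suc n)) {1 ∷ α} (_ ∷ ps) eq =
    ∈-++⁺ˡ (∈-map⁺ (1 ∷_) (compositions-complete (suc n) ps (suc-injective eq)))
  compositions-complete (suc (suc n)) {suc (suc a) ∷ α} (_ ∷ ps) eq =
    ∈-++⁺ʳ (map (1 ∷_) (compositions (suc n)))
      (∈-map⁺ incHead (compositions-complete (suc n) {suc a ∷ α} (_ ∷ ps) (suc-injective eq)))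

  incHead-injective : ∀ {α β} → incHead α ≡ incHead β → α ≡ β
  incHead-injective {[]}    {[]}    _    = refl
  incHead-injective {_ ∷ _} {_ ∷ _} refl = refl

  compositions-unique : ∀ n → Unique (compositions n)
  compositions-unique 0             = [] ∷ []
  compositions-unique 1             = [] ∷ []
  compositions-unique (suc (suc n)) = Unique.++⁺
    (Unique.map⁺ ∷-injectiveʳ (compositions-unique (suc n)))
    (Unique.map⁺ incHead-injective (compositions-unique (suc n)))
    λ (v∈₁ , v∈₂) → disjoint (∈-map⁻ (1 ∷_) v∈₁) (∈-map⁻ incHead v∈₂)
    where
    disjoint : ∀ {v} → ∃ (λ β → β ∈ compositions (suc n) × v ≡ 1 ∷ β) →
               ∃ (λ γ → γ ∈ compositions (suc n) × v ≡ incHead γ) → ⊥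
    disjoint (β , _ , refl) (0 ∷ γ , γ∈ , refl) with () ∷ _ ← All.lookup (compositions-positive (suc n)) γ∈

deviationSets : (m δ : ℕ) → List (List ℕ)
deviationSets m δ = filter (deviationSet? m δ) (compositions m)

∈-deviationSets : ∀ m δ α → α ∈ deviationSets m δ ⇔ IsDeviationSet m δ α
∈-deviationSets m δ α = mk⇔
  (λ α∈ → proj₂ (∈-filter⁻ (deviationSet? m δ) {xs = compositions m} α∈))
  (λ h → let open IsDeviationSet h in
    ∈-filter⁺ (deviationSet? m δ) (compositions-complete m positive size) h)

deviationSets-unique : ∀ m δ → Unique (deviationSets m δ)
deviationSets-unique m δ = Unique.filter⁺ (deviationSet? m δ) (compositions-unique m)

ζ : (m δ : ℕ) → ℕ
ζ m δ = length (deviationSets m δ)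

-- Polynomials are coefficient lists, constant term first; trailing zeros are
-- allowed, so equality is equality of all coefficients.
module Polynomial (R : RawRing c ℓ) where
  open RawRing R renaming (_+_ to _+ᴿ_)

  Poly : Set c
  Poly = List Carrier

  coeff : Poly → ℕ → Carrier
  coeff []      _       = 0#
  coeff (a ∷ p) zero    = a
  coeff (a ∷ p) (suc n) = coeff p n

  infix 4 _≋_
  _≋_ : Poly → Poly → Set ℓ
  p ≋ q = ∀ n → coeff p n ≈ coeff q n

  infixl 6 _+ₚ_
  _+ₚ_ : Poly → Poly → Poly
  []      +ₚ q       = q
  (a ∷ p) +ₚ []      = a ∷ p
  (a ∷ p) +ₚ (b ∷ q) = (a +ᴿ b) ∷ (p +ₚ q)

  infix 8 -ₚ_
  -ₚ_ : Poly → Poly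
  -ₚ_ = map -_

  infixl 7 _*ₚ_
  _*ₚ_ : Poly → Poly → Poly
  []      *ₚ q = []
  (a ∷ p) *ₚ q = map (a *_) q +ₚ (0# ∷ p *ₚ q)

  C : Carrier → Poly
  C a = a ∷ []

  X : Poly
  X = 0# ∷ 1# ∷ []

  polyRing : RawRing c ℓ
  polyRing = record
    { Carrier = Poly ; _≈_ = _≋_ ; _+_ = _+ₚ_ ; _*_ = _*ₚ_ ; -_ = -ₚ_
    ; 0# = [] ; 1# = C 1# }

  eval : Poly → Carrier → Carrier
  eval []      x = 0#
  eval (a ∷ p) x = a +ᴿ x * eval p x

-- R[√D]: the pair (a , b) stands for a + b √D.
quadraticExtension : (R : RawRing c ℓ) → RawRing.Carrier R → RawRing c ℓ
quadraticExtension R D = record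
  { Carrier = Carrier × Carrier
  ; _≈_ = λ (a , b) (a′ , b′) → (a ≈ a′) × (b ≈ b′)
  ; _+_ = λ (a , b) (a′ , b′) → a +ᴿ a′ , b +ᴿ b′
  ; _*_ = λ (a , b) (a′ , b′) → a * a′ +ᴿ D * (b * b′) , a * b′ +ᴿ b * a′
  ; -_  = λ (a , b) → - a , - b
  ; 0#  = 0# , 0#
  ; 1#  = 1# , 0#
  }
  where open RawRing R renaming (_+_ to _+ᴿ_)

module _ (K : HeytingField c ℓ₁ ℓ₂) where
  open HeytingField K using (_#_; 0#; 1#; heytingCommutativeRing)
  open CommutativeRing (HeytingCommutativeRing.commutativeRing heytingCommutativeRing)
    using (rawRing)
  open RawSemiringDefinitions (RawRing.rawSemiring rawRing) using () renaming (_×_ to _·_)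

  CharacteristicZero : Set ℓ₂
  CharacteristicZero = ∀ n → .{{NonZero n}} → (n · 1#) # 0#

-- Heyting fields include the constructive real and complex numbers as well as
-- discrete fields such as ℚ and its extensions.
module CharZeroField (K : HeytingField c ℓ₁ ℓ₂) (char0 : CharacteristicZero K) where
  open HeytingField K public
    using (Carrier; _≈_; _#_; _*_; -_; _-_; 0#; 1#; heytingCommutativeRing; #⇒invertible)
    renaming (_+_ to _+ᴷ_)

  commutativeRing : CommutativeRing c ℓ₁
  commutativeRing = HeytingCommutativeRing.commutativeRing heytingCommutativeRing

  rawRing : RawRing c ℓ₁
  rawRing = CommutativeRing.rawRing commutativeRing

  open RawSemiringDefinitions (RawRing.rawSemiring rawRing) public
    using (_^_) renaming (_×_ to _·_; sum to Σ)

  open Polynomial rawRing public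

  private
    module P = RawSemiringDefinitions (RawRing.rawSemiring polyRing)

  fromℕ : ℕ → Carrier
  fromℕ n = n · 1#

  -- #⇒invertible literally inverts x - 0#.
  inv : (x : Carrier) → x # 0# → Carrier
  inv x x#0 = proj₁ (#⇒invertible x#0)

  infix 9 1/_
  1/_ : (n : ℕ) → .{{NonZero n}} → Carrier
  1/ n = inv (fromℕ n) (char0 n)

  1-4X : Poly
  1-4X = C 1# +ₚ -ₚ (C (fromℕ 4) *ₚ X)

  private
    K[X,√] : RawRing c ℓ₁
    K[X,√] = quadraticExtension polyRing 1-4X

    module Q = RawRing K[X,√]
    module QS = RawSemiringDefinitions Q.rawSemiring

  -- (1 ± √(1 - 4X)) / 2
  u v : Poly × Poly
  u = C (1/ 2) , C (1/ 2)
  v = C (1/ 2) , -ₚ C (1/ 2)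

  binet : ℕ → Poly × Poly
  binet δ = (u QS.^ suc δ) Q.+ (v QS.^ suc δ)

  -- The √-component of the sum is zero: see √-part-vanishes and eval-p below.
  p : ℕ → Poly
  p δ = proj₁ (binet δ)

  HasDegree : Poly → ℕ → Set (ℓ₁ ⊔ ℓ₂)
  HasDegree f d = (coeff f d # 0#) × (∀ k → d < k → coeff f k ≈ 0#)

  -- For f of degree d: ϑ lists all roots of f, with multiplicity.
  AreRootsOf : ∀ {d} → Vector Carrier d → Poly → Set ℓ₁
  AreRootsOf {d} ϑ f = f ≋ C (coeff f d) *ₚ P.product (λ i → X +ₚ -ₚ C (ϑ i))

  private
    open CommutativeRing commutativeRing using (setoid; ring)
      renaming (refl to ≈-refl; sym to ≈-sym; trans to ≈-trans)
    module K = CommutativeRing commutativeRing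
    open RingProperties ring using (-0#≈0#; -‿+-comm; +-inverseˡ-unique; -‿distribˡ-*; -‿distribʳ-*)
    open CommutativeSemigroupProperties K.+-commutativeSemigroup using (interchange)
    open CommutativeSemigroupProperties K.*-commutativeSemigroup
      using (x∙yz≈y∙xz; xy∙z≈xz∙y) renaming (interchange to *-interchange)
    open SetoidReasoning setoid

    coeff-+ : ∀ f g n → coeff (f +ₚ g) n ≈ coeff f n +ᴷ coeff g n
    coeff-+ []      g       n       = ≈-sym (K.+-identityˡ _)
    coeff-+ (a ∷ f) []      n       = ≈-sym (K.+-identityʳ _)
    coeff-+ (a ∷ f) (b ∷ g) zero    = ≈-refl
    coeff-+ (a ∷ f) (b ∷ g) (suc n) = coeff-+ f g n

    coeff-scale : ∀ a f n → coeff (map (a *_) f) n ≈ a * coeff f n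
    coeff-scale a []      n       = ≈-sym (K.zeroʳ a)
    coeff-scale a (b ∷ f) zero    = ≈-refl
    coeff-scale a (b ∷ f) (suc n) = coeff-scale a f n

    *ₚ-congˡ : ∀ f {g h} → g ≋ h → f *ₚ g ≋ f *ₚ h
    *ₚ-congˡ []      eq n = ≈-refl
    *ₚ-congˡ (a ∷ f) {g} {h} eq n = begin
      coeff (map (a *_) g +ₚ (0# ∷ f *ₚ g)) n
        ≈⟨ coeff-+ (map (a *_) g) _ n ⟩
      coeff (map (a *_) g) n +ᴷ coeff (0# ∷ f *ₚ g) n
        ≈⟨ K.+-cong (≈-trans (coeff-scale a g n)
             (≈-trans (K.*-congˡ (eq n)) (≈-sym (coeff-scale a h n)))) (shift n) ⟩
      coeff (map (a *_) h) n +ᴷ coeff (0# ∷ f *ₚ h) n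
        ≈⟨ coeff-+ (map (a *_) h) _ n ⟨
      coeff (map (a *_) h +ₚ (0# ∷ f *ₚ h)) n ∎
      where
      shift : ∀ n → coeff (0# ∷ f *ₚ g) n ≈ coeff (0# ∷ f *ₚ h) n
      shift zero    = ≈-refl
      shift (suc n) = *ₚ-congˡ f eq n

    coeff-C : ∀ a f n → coeff (C a *ₚ f) n ≈ a * coeff f n
    coeff-C a f n = begin
      coeff (map (a *_) f +ₚ (0# ∷ [])) n       ≈⟨ coeff-+ (map (a *_) f) _ n ⟩
      coeff (map (a *_) f) n +ᴷ coeff (0# ∷ []) n ≈⟨ K.+-cong (coeff-scale a f n) (zeros n) ⟩
      a * coeff f n +ᴷ 0#                       ≈⟨ K.+-identityʳ _ ⟩
      a * coeff f n                             ∎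
      where
      zeros : ∀ n → coeff (0# ∷ []) n ≈ 0#
      zeros zero    = ≈-refl
      zeros (suc n) = ≈-refl

    conjugate : ∀ n → (proj₁ (u QS.^ n) ≋ proj₁ (v QS.^ n)) ×
                      (∀ k → coeff (proj₂ (u QS.^ n)) k +ᴷ coeff (proj₂ (v QS.^ n)) k ≈ 0#)
    conjugate zero    = (λ k → ≈-refl) , λ k → K.+-identityˡ 0#
    conjugate (suc n) with u QS.^ n | v QS.^ n | conjugate n
    ... | a , b | a′ , b′ | a≋a′ , b+b′≋0 = same , opposite
      where
      h = 1/ 2

      hb≋-hb′ : C h *ₚ b ≋ -ₚ C h *ₚ b′
      hb≋-hb′ k = begin
        coeff (C h *ₚ b) k     ≈⟨ coeff-C h b k ⟩
        h * coeff b k          ≈⟨ K.*-congˡ (+-inverseˡ-unique _ _ (b+b′≋0 k)) ⟩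
        h * - coeff b′ k       ≈⟨ -‿distribʳ-* h _ ⟨
        - (h * coeff b′ k)     ≈⟨ -‿distribˡ-* h _ ⟩
        - h * coeff b′ k       ≈⟨ coeff-C (- h) b′ k ⟨
        coeff (-ₚ C h *ₚ b′) k ∎

      same : C h *ₚ a +ₚ 1-4X *ₚ (C h *ₚ b) ≋ C h *ₚ a′ +ₚ 1-4X *ₚ (-ₚ C h *ₚ b′)
      same k = begin
        coeff (C h *ₚ a +ₚ 1-4X *ₚ (C h *ₚ b)) k
          ≈⟨ coeff-+ (C h *ₚ a) _ k ⟩
        coeff (C h *ₚ a) k +ᴷ coeff (1-4X *ₚ (C h *ₚ b)) k
          ≈⟨ K.+-cong (*ₚ-congˡ (C h) {a} {a′} a≋a′ k)
                      (*ₚ-congˡ 1-4X {C h *ₚ b} { -ₚ C h *ₚ b′} hb≋-hb′ k) ⟩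
        coeff (C h *ₚ a′) k +ᴷ coeff (1-4X *ₚ (-ₚ C h *ₚ b′)) k
          ≈⟨ coeff-+ (C h *ₚ a′) _ k ⟨
        coeff (C h *ₚ a′ +ₚ 1-4X *ₚ (-ₚ C h *ₚ b′)) k ∎

      opposite : ∀ k → coeff (C h *ₚ b +ₚ C h *ₚ a) k +ᴷ
                       coeff (C h *ₚ b′ +ₚ -ₚ C h *ₚ a′) k ≈ 0#
      opposite k = begin
        coeff (C h *ₚ b +ₚ C h *ₚ a) k +ᴷ coeff (C h *ₚ b′ +ₚ -ₚ C h *ₚ a′) k
          ≈⟨ K.+-cong (coeff-+ (C h *ₚ b) _ k) (coeff-+ (C h *ₚ b′) _ k) ⟩
        (coeff (C h *ₚ b) k +ᴷ coeff (C h *ₚ a) k) +ᴷ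
        (coeff (C h *ₚ b′) k +ᴷ coeff (-ₚ C h *ₚ a′) k)
          ≈⟨ interchange _ _ _ _ ⟩
        (coeff (C h *ₚ b) k +ᴷ coeff (C h *ₚ b′) k) +ᴷ
        (coeff (C h *ₚ a) k +ᴷ coeff (-ₚ C h *ₚ a′) k)
          ≈⟨ K.+-cong (K.+-cong (coeff-C h b k) (coeff-C h b′ k))
                      (K.+-cong (coeff-C h a k) (coeff-C (- h) a′ k)) ⟩
        (h * coeff b k +ᴷ h * coeff b′ k) +ᴷ (h * coeff a k +ᴷ - h * coeff a′ k)
          ≈⟨ K.+-cong (K.distribˡ h _ _) (K.+-cong (K.*-congˡ (≈-sym (a≋a′ k))) (-‿distribˡ-* h _)) ⟨
        h * (coeff b k +ᴷ coeff b′ k) +ᴷ (h * coeff a′ k +ᴷ - (h * coeff a′ k))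
          ≈⟨ K.+-cong (≈-trans (K.*-congˡ (b+b′≋0 k)) (K.zeroʳ h)) (K.-‿inverseʳ _) ⟩
        0# +ᴷ 0#
          ≈⟨ K.+-identityˡ 0# ⟩
        0# ∎

  √-part-vanishes : ∀ δ → proj₂ (binet δ) ≋ []
  √-part-vanishes δ k =
    ≈-trans (coeff-+ (proj₂ (u QS.^ suc δ)) _ k) (proj₂ (conjugate (suc δ)) k)

  private
    eval-+ : ∀ f g x → eval (f +ₚ g) x ≈ eval f x +ᴷ eval g x
    eval-+ []      g       x = ≈-sym (K.+-identityˡ _)
    eval-+ (a ∷ f) []      x = ≈-sym (K.+-identityʳ _)
    eval-+ (a ∷ f) (b ∷ g) x = begin
      (a +ᴷ b) +ᴷ x * eval (f +ₚ g) x
        ≈⟨ K.+-congˡ (≈-trans (K.*-congˡ (eval-+ f g x)) (K.distribˡ x _ _)) ⟩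
      (a +ᴷ b) +ᴷ (x * eval f x +ᴷ x * eval g x)
        ≈⟨ interchange _ _ _ _ ⟩
      (a +ᴷ x * eval f x) +ᴷ (b +ᴷ x * eval g x) ∎

    eval-scale : ∀ a f x → eval (map (a *_) f) x ≈ a * eval f x
    eval-scale a []      x = ≈-sym (K.zeroʳ a)
    eval-scale a (b ∷ f) x = begin
      a * b +ᴷ x * eval (map (a *_) f) x ≈⟨ K.+-congˡ (K.*-congˡ (eval-scale a f x)) ⟩
      a * b +ᴷ x * (a * eval f x)        ≈⟨ K.+-congˡ (x∙yz≈y∙xz x a _) ⟩
      a * b +ᴷ a * (x * eval f x)        ≈⟨ K.distribˡ a b _ ⟨
      a * (b +ᴷ x * eval f x)            ∎

    eval-* : ∀ f g x → eval (f *ₚ g) x ≈ eval f x * eval g x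
    eval-* []      g x = ≈-sym (K.zeroˡ _)
    eval-* (a ∷ f) g x = begin
      eval (map (a *_) g +ₚ (0# ∷ f *ₚ g)) x
        ≈⟨ eval-+ (map (a *_) g) _ x ⟩
      eval (map (a *_) g) x +ᴷ (0# +ᴷ x * eval (f *ₚ g) x)
        ≈⟨ K.+-cong (eval-scale a g x) (≈-trans (K.+-identityˡ _) (K.*-congˡ (eval-* f g x))) ⟩
      a * eval g x +ᴷ x * (eval f x * eval g x)
        ≈⟨ K.+-congˡ (K.*-assoc x _ _) ⟨
      a * eval g x +ᴷ (x * eval f x) * eval g x
        ≈⟨ K.distribʳ _ a _ ⟨
      (a +ᴷ x * eval f x) * eval g x ∎

    eval-C : ∀ a x → eval (C a) x ≈ a
    eval-C a x = ≈-trans (K.+-congˡ (K.zeroʳ x)) (K.+-identityʳ a)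

    eval-neg : ∀ f x → eval (-ₚ f) x ≈ - eval f x
    eval-neg []      x = ≈-sym -0#≈0#
    eval-neg (a ∷ f) x = begin
      - a +ᴷ x * eval (-ₚ f) x    ≈⟨ K.+-congˡ (K.*-congˡ (eval-neg f x)) ⟩
      - a +ᴷ x * - eval f x       ≈⟨ K.+-congˡ (-‿distribʳ-* x _) ⟨
      - a +ᴷ - (x * eval f x)     ≈⟨ -‿+-comm a _ ⟩
      - (a +ᴷ x * eval f x)       ∎

    eval-X : ∀ x → eval X x ≈ x
    eval-X x = ≈-trans (K.+-identityˡ _) (≈-trans (K.*-congˡ (eval-C 1# x)) (K.*-identityʳ x))

    eval-1-4X : ∀ x → eval 1-4X x ≈ 1# - fromℕ 4 * x
    eval-1-4X x = begin
      eval 1-4X x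
        ≈⟨ eval-+ (C 1#) (-ₚ (C (fromℕ 4) *ₚ X)) x ⟩
      eval (C 1#) x +ᴷ eval (-ₚ (C (fromℕ 4) *ₚ X)) x
        ≈⟨ K.+-cong (eval-C 1# x) (eval-neg (C (fromℕ 4) *ₚ X) x) ⟩
      1# - eval (C (fromℕ 4) *ₚ X) x
        ≈⟨ K.+-congˡ (K.-‿cong (≈-trans (eval-* (C (fromℕ 4)) X x)
             (K.*-cong (eval-C (fromℕ 4) x) (eval-X x)))) ⟩
      1# - fromℕ 4 * x ∎

    eval-≋[] : ∀ f x → f ≋ [] → eval f x ≈ 0#
    eval-≋[] []      x f≋0 = ≈-refl
    eval-≋[] (a ∷ f) x f≋0 = begin
      a +ᴷ x * eval f x ≈⟨ K.+-cong (f≋0 0) (K.*-congˡ (eval-≋[] f x (λ n → f≋0 (suc n)))) ⟩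
      0# +ᴷ x * 0#      ≈⟨ ≈-trans (K.+-identityˡ _) (K.zeroʳ x) ⟩
      0#                ∎

    module Evaluation (x s : Carrier) (s²≈1-4x : s * s ≈ 1# - fromℕ 4 * x) where

      evalQ : Poly × Poly → Carrier
      evalQ (a , b) = eval a x +ᴷ eval b x * s

      evalQ-+ : ∀ f g → evalQ (f Q.+ g) ≈ evalQ f +ᴷ evalQ g
      evalQ-+ (a , b) (a′ , b′) = begin
        eval (a +ₚ a′) x +ᴷ eval (b +ₚ b′) x * s
          ≈⟨ K.+-cong (eval-+ a a′ x) (≈-trans (K.*-congʳ (eval-+ b b′ x)) (K.distribʳ s _ _)) ⟩
        (eval a x +ᴷ eval a′ x) +ᴷ (eval b x * s +ᴷ eval b′ x * s)
          ≈⟨ interchange _ _ _ _ ⟩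
        (eval a x +ᴷ eval b x * s) +ᴷ (eval a′ x +ᴷ eval b′ x * s) ∎

      evalQ-* : ∀ f g → evalQ (f Q.* g) ≈ evalQ f * evalQ g
      evalQ-* (a , b) (a′ , b′) = begin
        eval (a *ₚ a′ +ₚ 1-4X *ₚ (b *ₚ b′)) x +ᴷ eval (a *ₚ b′ +ₚ b *ₚ a′) x * s
          ≈⟨ K.+-cong
               (≈-trans (eval-+ (a *ₚ a′) _ x) (K.+-cong (eval-* a a′ x)
                 (≈-trans (eval-* 1-4X (b *ₚ b′) x) (K.*-cong D≈s² (eval-* b b′ x)))))
               (K.*-congʳ (≈-trans (eval-+ (a *ₚ b′) _ x) (K.+-cong (eval-* a b′ x) (eval-* b a′ x)))) ⟩
        (A * A′ +ᴷ (s * s) * (B * B′)) +ᴷ (A * B′ +ᴷ B * A′) * s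
          ≈⟨ K.+-cong (K.+-congˡ s²BB′) (≈-trans (K.distribʳ s _ _) (K.+-comm _ _)) ⟩
        (A * A′ +ᴷ (B * s) * (B′ * s)) +ᴷ ((B * A′) * s +ᴷ (A * B′) * s)
          ≈⟨ interchange _ _ _ _ ⟩
        (A * A′ +ᴷ (B * A′) * s) +ᴷ ((B * s) * (B′ * s) +ᴷ (A * B′) * s)
          ≈⟨ K.+-cong (K.+-congˡ (xy∙z≈xz∙y B A′ s))
                      (≈-trans (K.+-comm _ _) (K.+-congʳ (K.*-assoc A B′ s))) ⟩
        (A * A′ +ᴷ (B * s) * A′) +ᴷ (A * (B′ * s) +ᴷ (B * s) * (B′ * s))
          ≈⟨ K.+-cong (K.distribʳ A′ A _) (K.distribʳ (B′ * s) A _) ⟨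
        (A +ᴷ B * s) * A′ +ᴷ (A +ᴷ B * s) * (B′ * s)
          ≈⟨ K.distribˡ _ A′ _ ⟨
        (A +ᴷ B * s) * (A′ +ᴷ B′ * s) ∎
        where
        A  = eval a x
        B  = eval b x
        A′ = eval a′ x
        B′ = eval b′ x
        D≈s² : eval 1-4X x ≈ s * s
        D≈s² = ≈-trans (eval-1-4X x) (≈-sym s²≈1-4x)
        s²BB′ : (s * s) * (B * B′) ≈ (B * s) * (B′ * s)
        s²BB′ = ≈-trans (*-interchange s s B B′) (K.*-cong (K.*-comm s B) (K.*-comm s B′))

      evalQ-^ : ∀ f n {y} → evalQ f ≈ y → evalQ (f QS.^ n) ≈ y ^ n
      evalQ-^ f zero    eq = ≈-trans (K.+-cong (eval-C 1# x) (K.zeroˡ s)) (K.+-identityʳ 1#)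
      evalQ-^ f (suc n) eq = ≈-trans (evalQ-* f (f QS.^ n)) (K.*-cong eq (evalQ-^ f n eq))

      evalQ-u : evalQ u ≈ 1/ 2 * (1# +ᴷ s)
      evalQ-u = begin
        eval (C (1/ 2)) x +ᴷ eval (C (1/ 2)) x * s
          ≈⟨ K.+-cong (eval-C _ x) (K.*-congʳ (eval-C _ x)) ⟩
        1/ 2 +ᴷ 1/ 2 * s      ≈⟨ K.+-congʳ (K.*-identityʳ _) ⟨
        1/ 2 * 1# +ᴷ 1/ 2 * s ≈⟨ K.distribˡ _ 1# s ⟨
        1/ 2 * (1# +ᴷ s)      ∎

      evalQ-v : evalQ v ≈ 1/ 2 * (1# - s)
      evalQ-v = begin
        eval (C (1/ 2)) x +ᴷ eval (-ₚ C (1/ 2)) x * s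
          ≈⟨ K.+-cong (eval-C _ x) (K.*-congʳ (eval-C _ x)) ⟩
        1/ 2 +ᴷ - (1/ 2) * s    ≈⟨ K.+-cong (K.*-identityʳ _) (-‿distribˡ-* _ s) ⟨
        1/ 2 * 1# - 1/ 2 * s    ≈⟨ K.+-congˡ (-‿distribʳ-* _ s) ⟩
        1/ 2 * 1# +ᴷ 1/ 2 * - s ≈⟨ K.distribˡ _ 1# (- s) ⟨
        1/ 2 * (1# - s)         ∎

  eval-p : ∀ δ x s → s * s ≈ 1# - fromℕ 4 * x →
           eval (p δ) x ≈ (1/ 2 * (1# +ᴷ s)) ^ suc δ +ᴷ (1/ 2 * (1# - s)) ^ suc δ
  eval-p δ x s s² = begin
    eval (p δ) x
      ≈⟨ K.+-identityʳ _ ⟨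
    eval (p δ) x +ᴷ 0#
      ≈⟨ K.+-congˡ (≈-trans (K.*-congʳ (eval-≋[] (proj₂ (binet δ)) x (√-part-vanishes δ))) (K.zeroˡ s)) ⟨
    evalQ (binet δ)
      ≈⟨ evalQ-+ (u QS.^ suc δ) (v QS.^ suc δ) ⟩
    evalQ (u QS.^ suc δ) +ᴷ evalQ (v QS.^ suc δ)
      ≈⟨ K.+-cong (evalQ-^ u (suc δ) evalQ-u) (evalQ-^ v (suc δ) evalQ-v) ⟩
    (1/ 2 * (1# +ᴷ s)) ^ suc δ +ᴷ (1/ 2 * (1# - s)) ^ suc δ ∎
    where open Evaluation x s s²

{-# OPTIONS --safe #-}
module Submission where

-- Read a deviation set as a walk on ℤ with runs of lengths α₁, α₂, … going
-- alternately up and down: ζ(m, δ) counts the walks of length m starting with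
-- an up-step, staying in [-δ, δ] and ending in {-1, 0, 1}.  The series
-- cₖ(x) = Σₙ #{walks from k to 0 of length 2n + k} xⁿ satisfy
-- cₖ = cₖ₋₁ + x cₖ₊₁ for 1 ≤ k ≤ δ, c₀ = 1 + 2x c₁ and c_{δ+1} = 0.  With
-- u + v = 1, u v = x and gₙ = (uⁿ - vⁿ)/(u - v), the recurrence run downwards
-- gives c₁ p_δ = g_δ, while p_δ = u^(δ+1) + v^(δ+1) has derivative
-- -(δ+1) g_δ.  So (δ+1) x c₁ = -x p_δ'/p_δ, which is Σᵢ Σ_{n≥1} (x/ϑᵢ)ⁿ.

open import Level using (Level)
open import Algebra.Apartness.Bundles using (HeytingField)
import Algebra.Apartness.Properties.HeytingCommutativeRing as HeytingProperties
open import Algebra.Bundles using (CommutativeRing; RawRing)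
import Algebra.Definitions.RawSemiring as RawSemiringDefinitions
import Algebra.Properties.CommutativeMonoid.Mult as CommutativeMonoidMult
import Algebra.Properties.CommutativeSemigroup as CommutativeSemigroupProperties
import Algebra.Properties.Ring as RingProperties
import Algebra.Properties.Semiring.Mult as SemiringMult
import Algebra.Solver.Ring.NaturalCoefficients.Default as SemiringSolver
open import Data.Bool.Base using (true; false; if_then_else_; _∧_)
open import Data.Empty using (⊥-elim)
open import Data.Fin.Base using (zero; suc)
import Data.Integer.Properties as ℤ
open import Data.Integer.Solver using (module +-*-Solver)
open import Data.List.Base using (List; []; _∷_; _++_; map; filter; length; take)
open import Data.List.Properties using (filter-++; filter-accept; filter-reject; filter-none; length-++)
open import Data.List.Relation.Unary.All as All using (All; []; _∷_)
import Data.List.Relation.Unary.All.Properties as All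
open import Data.Nat.Base using (ℕ; zero; suc; _≤_; s≤s; NonZero; ⌊_/2⌋) renaming (_+_ to _+ℕ_)
open import Data.Nat.ListAction using (sum)
import Data.Nat.Properties as ℕ
open import Data.Product.Base using (Σ-syntax; _×_; _,_; proj₁; proj₂)
open import Data.Sum.Base as Sum using (_⊎_; inj₁; inj₂)
open import Data.Unit.Base using (⊤)
open import Data.Vec.Functional using (Vector)
open import Function.Base using (_∘_)
open import Function.Bundles using (_⇔_; mk⇔; Equivalence)
open import Relation.Binary.PropositionalEquality as ≡ using (_≡_)
import Relation.Binary.Reasoning.Setoid as SetoidReasoning
open import Relation.Nullary.Decidable using (yes; no; does; _×-dec_)
open import Relation.Nullary.Negation using (¬_)
open import Relation.Unary using (Pred; Decidable)
open import Defs

-- Boundedness is imposed only at the ends of runs. The height is monotone within a run, so this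
-- confines every step, and the walks can be counted one step at a time. A walk of even size ends at
-- 0 and one of odd size at 1 or -1, while the series see only returns to 0. A walk ending at 1 or
-- -1 extends to 0 in exactly one way, so odd sizes round up to even ones; this is the source of
-- ⌊(m+1)/2⌋. No quotient of series is formed. A logarithmic derivative -s of a is recorded as θ a +
-- a s = 0 with θ = x d/dx, and the value p_δ(0) = 1 does the dividing: it lets p_δ be cancelled
-- coefficient by coefficient and exhibits an inverse of each root.

private variable
  c ℓ : Level

-- Formal power series and their Euler derivation.

module PowerSeries (R : CommutativeRing c ℓ) where
  open CommutativeRing R
  open SemiringMult semiring using (×-congʳ; ×-comm-*) renaming (_×_ to _·_)
  open CommutativeMonoidMult +-commutativeMonoid using (×-distrib-+)
  open CommutativeSemigroupProperties +-commutativeSemigroup using (interchange; x∙yz≈y∙xz)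
  open RingProperties ring using (+-cancelʳ)
  open SetoidReasoning setoid

  Series : Set c
  Series = ℕ → Carrier

  infix 4 _≈ˢ_
  _≈ˢ_ : Series → Series → Set ℓ
  a ≈ˢ b = ∀ n → a n ≈ b n

  infixl 6 _⊕_
  _⊕_ : Series → Series → Series
  (a ⊕ b) n = a n + b n

  infixl 7 _⊛_
  -- The Cauchy product, by recursion on a = a₀ + x a′, which avoids finite sums over pairs of
  -- indices.
  _⊛_ : Series → Series → Series
  (a ⊛ b) zero    = a 0 * b 0
  (a ⊛ b) (suc n) = a 0 * b (suc n) + ((a ∘ suc) ⊛ b) n

  const : Carrier → Series
  const k zero    = k
  const k (suc n) = 0#

  x : Series
  x zero    = 0#
  x (suc n) = const 1# n

  ⊛-cong : ∀ {a a′ b b′} → a ≈ˢ a′ → b ≈ˢ b′ → a ⊛ b ≈ˢ a′ ⊛ b′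
  ⊛-cong p q zero    = *-cong (p 0) (q 0)
  ⊛-cong p q (suc n) = +-cong (*-cong (p 0) (q (suc n))) (⊛-cong (p ∘ suc) q n)

  ⊛-zeroˡ : ∀ a → (λ _ → 0#) ⊛ a ≈ˢ λ _ → 0#
  ⊛-zeroˡ a zero    = zeroˡ _
  ⊛-zeroˡ a (suc n) = trans (+-cong (zeroˡ _) (⊛-zeroˡ a n)) (+-identityˡ 0#)

  const-⊛ : ∀ k a n → (const k ⊛ a) n ≈ k * a n
  const-⊛ k a zero    = refl
  const-⊛ k a (suc n) = trans (+-congˡ (⊛-zeroˡ a n)) (+-identityʳ _)

  x-⊛-suc : ∀ a n → (x ⊛ a) (suc n) ≈ a n
  x-⊛-suc a n = begin
    0# * a (suc n) + (const 1# ⊛ a) n ≈⟨ +-cong (zeroˡ _) (const-⊛ 1# a n) ⟩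
    0# + 1# * a n                     ≈⟨ trans (+-identityˡ _) (*-identityˡ _) ⟩
    a n                               ∎

  -- The defining recursion peels the left factor; this one peels the right. Commutativity is the
  -- comparison of the two.
  ⊛-sucʳ : ∀ a b n → (a ⊛ b) (suc n) ≈ (a ⊛ (b ∘ suc)) n + a (suc n) * b 0
  ⊛-sucʳ a b zero    = refl
  ⊛-sucʳ a b (suc n) = trans (+-congˡ (⊛-sucʳ (a ∘ suc) b n)) (sym (+-assoc _ _ _))

  ⊛-comm : ∀ a b → a ⊛ b ≈ˢ b ⊛ a
  ⊛-comm a b zero    = *-comm _ _
  ⊛-comm a b (suc n) = begin
    a 0 * b (suc n) + ((a ∘ suc) ⊛ b) n ≈⟨ +-cong (*-comm _ _) (⊛-comm (a ∘ suc) b n) ⟩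
    b (suc n) * a 0 + (b ⊛ (a ∘ suc)) n ≈⟨ +-comm _ _ ⟩
    (b ⊛ (a ∘ suc)) n + b (suc n) * a 0 ≈⟨ ⊛-sucʳ b a n ⟨
    (b ⊛ a) (suc n)                     ∎

  ⊛-distribʳ : ∀ d a b → (a ⊕ b) ⊛ d ≈ˢ (a ⊛ d) ⊕ (b ⊛ d)
  ⊛-distribʳ d a b zero    = distribʳ _ _ _
  ⊛-distribʳ d a b (suc n) =
    trans (+-cong (distribʳ _ _ _) (⊛-distribʳ d (a ∘ suc) (b ∘ suc) n)) (interchange _ _ _ _)

  ⊛-distribˡ : ∀ d a b → d ⊛ (a ⊕ b) ≈ˢ (d ⊛ a) ⊕ (d ⊛ b)
  ⊛-distribˡ d a b n = begin
    (d ⊛ (a ⊕ b)) n           ≈⟨ ⊛-comm d (a ⊕ b) n ⟩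
    ((a ⊕ b) ⊛ d) n           ≈⟨ ⊛-distribʳ d a b n ⟩
    (a ⊛ d) n + (b ⊛ d) n     ≈⟨ +-cong (⊛-comm a d n) (⊛-comm b d n) ⟩
    (d ⊛ a) n + (d ⊛ b) n     ∎

  scale-⊛ : ∀ k a b n → ((λ i → k * a i) ⊛ b) n ≈ k * (a ⊛ b) n
  scale-⊛ k a b zero    = *-assoc _ _ _
  scale-⊛ k a b (suc n) = begin
    k * a 0 * b (suc n) + ((λ i → k * a (suc i)) ⊛ b) n
      ≈⟨ +-cong (*-assoc _ _ _) (scale-⊛ k (a ∘ suc) b n) ⟩
    k * (a 0 * b (suc n)) + k * ((a ∘ suc) ⊛ b) n
      ≈⟨ distribˡ k _ _ ⟨
    k * (a ⊛ b) (suc n) ∎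

  ⊛-assoc : ∀ a b d → (a ⊛ b) ⊛ d ≈ˢ a ⊛ (b ⊛ d)
  ⊛-assoc a b d zero    = *-assoc _ _ _
  ⊛-assoc a b d (suc n) = begin
    a 0 * b 0 * d (suc n) + (((λ i → a 0 * b (suc i)) ⊕ ((a ∘ suc) ⊛ b)) ⊛ d) n
      ≈⟨ +-cong (*-assoc _ _ _) (⊛-distribʳ d _ _ n) ⟩
    a 0 * (b 0 * d (suc n)) + (((λ i → a 0 * b (suc i)) ⊛ d) n + (((a ∘ suc) ⊛ b) ⊛ d) n)
      ≈⟨ +-congˡ (+-cong (scale-⊛ (a 0) (b ∘ suc) d n) (⊛-assoc (a ∘ suc) b d n)) ⟩
    a 0 * (b 0 * d (suc n)) + (a 0 * ((b ∘ suc) ⊛ d) n + ((a ∘ suc) ⊛ (b ⊛ d)) n)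
      ≈⟨ +-assoc _ _ _ ⟨
    (a 0 * (b 0 * d (suc n)) + a 0 * ((b ∘ suc) ⊛ d) n) + ((a ∘ suc) ⊛ (b ⊛ d)) n
      ≈⟨ +-congʳ (distribˡ (a 0) _ _) ⟨
    (a ⊛ (b ⊛ d)) (suc n) ∎

  ⊛-identityˡ : ∀ a → const 1# ⊛ a ≈ˢ a
  ⊛-identityˡ a n = trans (const-⊛ 1# a n) (*-identityˡ _)

  seriesRing : CommutativeRing c ℓ
  seriesRing = record
    { Carrier = Series ; _≈_ = _≈ˢ_ ; _+_ = _⊕_ ; _*_ = _⊛_ ; -_ = λ a n → - a n
    ; 0# = λ _ → 0# ; 1# = const 1#
    ; isCommutativeRing = record
      { isRing = record
        { +-isAbelianGroup = record
          { isGroup = record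
            { isMonoid = record
              { isSemigroup = record
                { isMagma = record
                  { isEquivalence = record
                    { refl = λ _ → refl ; sym = λ p n → sym (p n) ; trans = λ p q n → trans (p n) (q n) }
                  ; ∙-cong = λ p q n → +-cong (p n) (q n) }
                ; assoc = λ _ _ _ _ → +-assoc _ _ _ }
              ; identity = (λ _ _ → +-identityˡ _) , (λ _ _ → +-identityʳ _) }
            ; inverse = (λ _ _ → -‿inverseˡ _) , (λ _ _ → -‿inverseʳ _)
            ; ⁻¹-cong = λ p n → -‿cong (p n) }
          ; comm = λ _ _ _ → +-comm _ _ }
        ; *-cong = ⊛-cong
        ; *-assoc = ⊛-assoc
        ; *-identity = ⊛-identityˡ , λ a n → trans (⊛-comm a (const 1#) n) (⊛-identityˡ a n)
        ; distrib = ⊛-distribˡ , ⊛-distribʳ }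
      ; *-comm = ⊛-comm } }

  -- x d/dx
  θ : Series → Series
  θ a n = n · a n

  θ-cong : ∀ {a b} → a ≈ˢ b → θ a ≈ˢ θ b
  θ-cong p n = ×-congʳ n (p n)

  θ-⊕ : ∀ a b → θ (a ⊕ b) ≈ˢ θ a ⊕ θ b
  θ-⊕ a b n = ×-distrib-+ (a n) (b n) n

  -- For the tail a′ of a, the tail of θ a is a′ ⊕ θ a′. The extra a′ ⊛ b is matched by the one copy
  -- that `suc n · _` has beyond `n · _`.
  θ-⊛ : ∀ a b → θ (a ⊛ b) ≈ˢ (θ a ⊛ b) ⊕ (a ⊛ θ b)
  θ-⊛ a b zero    = sym (trans (+-cong (zeroˡ _) (zeroʳ _)) (+-identityˡ _))
  θ-⊛ a b (suc n) = begin
    (a 0 * b (suc n) + (a′ ⊛ b) n) + n · (a 0 * b (suc n) + (a′ ⊛ b) n)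
      ≈⟨ +-congˡ (trans (×-distrib-+ _ _ n) (+-cong (sym (×-comm-* n _ _)) (θ-⊛ a′ b n))) ⟩
    (a 0 * b (suc n) + (a′ ⊛ b) n) + (a 0 * (n · b (suc n)) + ((θ a′ ⊛ b) n + (a′ ⊛ θ b) n))
      ≈⟨ interchange _ _ _ _ ⟩
    (a 0 * b (suc n) + a 0 * (n · b (suc n))) + ((a′ ⊛ b) n + ((θ a′ ⊛ b) n + (a′ ⊛ θ b) n))
      ≈⟨ +-cong (distribˡ _ _ _) (trans (+-congʳ (⊛-distribʳ b a′ (θ a′) n)) (+-assoc _ _ _)) ⟨
    a 0 * (suc n · b (suc n)) + (((a′ ⊕ θ a′) ⊛ b) n + (a′ ⊛ θ b) n)
      ≈⟨ x∙yz≈y∙xz _ _ _ ⟩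
    ((a′ ⊕ θ a′) ⊛ b) n + (a ⊛ θ b) (suc n)
      ≈⟨ +-congʳ (trans (+-congʳ (zeroˡ _)) (+-identityˡ _)) ⟨
    (θ a ⊛ b) (suc n) + (a ⊛ θ b) (suc n) ∎
    where
    a′ = a ∘ suc

  -- Takes the place of division by a. Once the constant terms of b and d agree, the last summand in
  -- `⊛-sucʳ` drops out and the same equation holds for their tails.
  ⊛-cancelˡ : ∀ {a b d} → a 0 ≈ 1# → a ⊛ b ≈ˢ a ⊛ d → b ≈ˢ d
  ⊛-cancelˡ {a} {b} {d} a₀≈1 ab≈ad = b≈d
    where
    b₀≈d₀ : b 0 ≈ d 0
    b₀≈d₀ = begin
      b 0        ≈⟨ trans (*-congʳ a₀≈1) (*-identityˡ _) ⟨
      a 0 * b 0  ≈⟨ ab≈ad 0 ⟩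
      a 0 * d 0  ≈⟨ trans (*-congʳ a₀≈1) (*-identityˡ _) ⟩
      d 0        ∎
    ab′≈ad′ : a ⊛ (b ∘ suc) ≈ˢ a ⊛ (d ∘ suc)
    ab′≈ad′ n = +-cancelʳ (a (suc n) * b 0) _ _ (begin
      (a ⊛ (b ∘ suc)) n + a (suc n) * b 0   ≈⟨ ⊛-sucʳ a b n ⟨
      (a ⊛ b) (suc n)                       ≈⟨ ab≈ad (suc n) ⟩
      (a ⊛ d) (suc n)                       ≈⟨ ⊛-sucʳ a d n ⟩
      (a ⊛ (d ∘ suc)) n + a (suc n) * d 0   ≈⟨ +-congˡ (*-congˡ b₀≈d₀) ⟨
      (a ⊛ (d ∘ suc)) n + a (suc n) * b 0   ∎)
    b≈d : b ≈ˢ d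
    b≈d zero    = b₀≈d₀
    b≈d (suc n) = ⊛-cancelˡ a₀≈1 ab′≈ad′ n

-- Lucas sequences with u + v = 1 and u v = x, in any commutative ring.

module Lucas (R : CommutativeRing c ℓ) (x : CommutativeRing.Carrier R) where
  open CommutativeRing R
  open RingProperties ring using (+-cancelʳ)
  open SemiringMult semiring using () renaming (_×_ to _·_)
  open SemiringSolver commutativeSemiring using (solve; _:+_; _:*_; _:=_; con)
  open SetoidReasoning setoid

  -- (uⁿ - vⁿ) / (u - v), where u + v = 1 and u v = x.
  g : ℕ → Carrier
  g 0             = 0#
  g 1             = 1#
  g (suc (suc n)) = g (suc n) - x * g n

  -- Like `L+` and `rational+`, free of subtraction: the later identities become semiring
  -- identities, reached by adding a term to both sides and cancelling it.
  g-rec : ∀ n → g (suc (suc n)) + x * g n ≈ g (suc n)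
  g-rec n = trans (+-assoc _ _ _) (trans (+-congˡ (-‿inverseˡ _)) (+-identityʳ _))

  -- uⁿ⁺¹ + vⁿ⁺¹
  L : ℕ → Carrier
  L n = g (suc n) - (x + x) * g n

  -- The shape of `L` comes from uᵏ + vᵏ = gₖ₊₁ - x gₖ₋₁ at k = n + 1, with gₙ₊₂ expanded.
  L+ : ∀ n → L n + (x + x) * g n ≈ g (suc n)
  L+ n = trans (+-assoc _ _ _) (trans (+-congˡ (-‿inverseˡ _)) (+-identityʳ _))

  L-rec : ∀ n → L (suc (suc n)) + x * L n ≈ L (suc n)
  L-rec n = +-cancelʳ ((x + x) * g (suc n)) _ _ (begin
    (l₂ + x * l₀) + (x + x) * g (suc n)
      ≈⟨ +-congˡ (*-congˡ (g-rec n)) ⟨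
    (l₂ + x * l₀) + (x + x) * (g₂ + x * g n)
      ≈⟨ solve 5 (λ l₂ l₀ x g₂ g₀ → (l₂ :+ x :* l₀) :+ (x :+ x) :* (g₂ :+ x :* g₀)
           := (l₂ :+ (x :+ x) :* g₂) :+ x :* (l₀ :+ (x :+ x) :* g₀)) refl l₂ l₀ x g₂ (g n) ⟩
    (l₂ + (x + x) * g₂) + x * (l₀ + (x + x) * g n)
      ≈⟨ +-cong (L+ (suc (suc n))) (*-congˡ (L+ n)) ⟩
    g (suc (suc (suc n))) + x * g (suc n)
      ≈⟨ g-rec (suc n) ⟩
    g₂
      ≈⟨ L+ (suc n) ⟨
    L (suc n) + (x + x) * g (suc n) ∎)
    where
    l₀ = L n
    l₂ = L (suc (suc n))
    g₂ = g (suc (suc n))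

  module Binet (h D : Carrier) (h+h≈1 : h + h ≈ 1#) (D+4x≈1 : D + ((x + x) + (x + x)) ≈ 1#) where

    -- uⁿ = rational n + h (g n) √D, as u = (1 + √D) / 2; D stands for 1 - 4x.
    rational : ℕ → Carrier
    rational n = g (suc n) - h * g n

    rational+ : ∀ n → rational n + h * g n ≈ g (suc n)
    rational+ n = trans (+-assoc _ _ _) (trans (+-congˡ (-‿inverseˡ _)) (+-identityʳ _))

    rational-suc : ∀ n → h * rational n + D * (h * (h * g n)) ≈ rational (suc n)
    rational-suc n = +-cancelʳ (h * g (suc n)) _ _ (+-cancelʳ (x * g n) _ _ (begin
      (h * a + D * (h * (h * g n))) + h * g (suc n) + x * g n
        ≈⟨ +-congˡ (*-congʳ (*-identityˡ x)) ⟨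
      (h * a + D * (h * (h * g n))) + h * g (suc n) + (1# * x) * g n
        -- Inserting (h + h)(h + h) = 1 turns x gₙ into 4 h² x gₙ, which joins D h² gₙ so that D +
        -- 4x collapses to 1.
        ≈⟨ +-congˡ (*-congʳ (*-congʳ (trans (*-cong h+h≈1 h+h≈1) (*-identityˡ 1#)))) ⟨
      (h * a + D * (h * (h * g n))) + h * g (suc n) + ((h + h) * (h + h) * x) * g n
        ≈⟨ solve 6 (λ h a D x g g′ → (h :* a :+ D :* (h :* (h :* g))) :+ h :* g′ :+ ((h :+ h) :* (h :+ h) :* x) :* g
                    := h :* (a :+ (D :+ ((x :+ x) :+ (x :+ x))) :* (h :* g)) :+ h :* g′)
             refl h a D x (g n) (g (suc n)) ⟩
      h * (a + (D + ((x + x) + (x + x))) * (h * g n)) + h * g (suc n)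
        ≈⟨ +-congʳ (*-congˡ (+-congˡ (trans (*-congʳ D+4x≈1) (*-identityˡ _)))) ⟩
      h * (a + h * g n) + h * g (suc n)
        ≈⟨ +-congʳ (*-congˡ (rational+ n)) ⟩
      h * g (suc n) + h * g (suc n)
        ≈⟨ distribʳ _ _ _ ⟨
      (h + h) * g (suc n)
        ≈⟨ trans (*-congʳ h+h≈1) (*-identityˡ _) ⟩
      g (suc n)
        ≈⟨ g-rec n ⟨
      g (suc (suc n)) + x * g n
        ≈⟨ +-congʳ (rational+ (suc n)) ⟨
      rational (suc n) + h * g (suc n) + x * g n ∎))
      where
      a = rational n

    -- Conjugation flips only the √D part, so the trace of uⁿ⁺¹ is twice its rational part: 2 gₙ₊₂ -
    -- gₙ₊₁ = gₙ₊₁ - 2x gₙ.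
    rational≈L : ∀ n → rational (suc n) + rational (suc n) ≈ L n
    rational≈L n = +-cancelʳ ((x + x) * g n) _ _ (+-cancelʳ g₁ _ _ (begin
      (r + r) + (x + x) * g n + g₁
        ≈⟨ +-congˡ (trans (*-congʳ h+h≈1) (*-identityˡ _)) ⟨
      (r + r) + (x + x) * g n + (h + h) * g₁
        ≈⟨ solve 5 (λ r x g h g₁ → (r :+ r) :+ (x :+ x) :* g :+ (h :+ h) :* g₁
             := ((r :+ h :* g₁) :+ x :* g) :+ ((r :+ h :* g₁) :+ x :* g)) refl r x (g n) h g₁ ⟩
      ((r + h * g₁) + x * g n) + ((r + h * g₁) + x * g n)
        ≈⟨ +-cong r≈ r≈ ⟩
      g₁ + g₁
        ≈⟨ +-congʳ (L+ n) ⟨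
      L n + (x + x) * g n + g₁ ∎))
      where
      r  = rational (suc n)
      g₁ = g (suc n)
      r≈ : (r + h * g₁) + x * g n ≈ g₁
      r≈ = trans (+-congʳ (rational+ (suc n))) (g-rec n)

  -- The recurrence for c run downwards from c (suc δ) ≈ 0# is the one for g.
  module Chain (δ : ℕ) (c : ℕ → Carrier) (top : c (suc δ) ≈ 0#)
    (middle : ∀ k → suc k ≤ δ → c (suc k) ≈ c k + x * c (suc (suc k)))
    (bottom : c 0 ≈ 1# + (x + x) * c 1) where

    -- j is the distance below δ. Two neighbouring terms are carried because the recurrence has
    -- order two; the factor c δ remains free.
    descend : ∀ j k → j +ℕ k ≡ δ → c (suc k) ≈ c δ * g j × c k ≈ c δ * g (suc j)
    descend zero    k ≡.refl = trans top (sym (zeroʳ _)) , sym (*-identityʳ _)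
    descend (suc j) k eq with descend j (suc k) (≡.trans (ℕ.+-suc j k) eq)
    ... | ck₂ , ck₁ = ck₁ , +-cancelʳ (x * c (suc (suc k))) _ _ (begin
      c k + x * c (suc (suc k))
        ≈⟨ middle k (≡.subst (suc k ≤_) eq (s≤s (ℕ.m≤n+m k j))) ⟨
      c (suc k)
        ≈⟨ ck₁ ⟩
      t * g (suc j)
        ≈⟨ *-congˡ (g-rec j) ⟨
      t * (g (suc (suc j)) + x * g j)
        ≈⟨ solve 4 (λ t g₂ x g → t :* (g₂ :+ x :* g) := t :* g₂ :+ x :* (t :* g)) refl t (g (suc (suc j))) x (g j) ⟩
      t * g (suc (suc j)) + x * (t * g j)
        ≈⟨ +-congˡ (*-congˡ ck₂) ⟨
      t * g (suc (suc j)) + x * c (suc (suc k)) ∎)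
      where
      t = c δ

    -- `bottom` fixes the free factor t = c δ: t gδ₊₁ = 1 + 2x t gδ says t L δ = 1.
    c₁*L : c 1 * L δ ≈ g δ
    c₁*L = begin
      c 1 * L δ        ≈⟨ *-congʳ c₁ ⟩
      t * g δ * L δ    ≈⟨ solve 3 (λ t g l → t :* g :* l := (t :* l) :* g) refl t (g δ) (L δ) ⟩
      t * L δ * g δ    ≈⟨ trans (*-congʳ tL≈1) (*-identityˡ _) ⟩
      g δ              ∎
      where
      t = c δ
      c₁ = proj₁ (descend δ 0 (ℕ.+-identityʳ δ))
      c₀ = proj₂ (descend δ 0 (ℕ.+-identityʳ δ))
      tL≈1 : t * L δ ≈ 1#
      tL≈1 = +-cancelʳ ((x + x) * c 1) _ _ (begin
        t * L δ + (x + x) * c 1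
          ≈⟨ +-congˡ (*-congˡ c₁) ⟩
        t * L δ + (x + x) * (t * g δ)
          ≈⟨ solve 4 (λ t l y g → t :* l :+ y :* (t :* g) := t :* (l :+ y :* g)) refl t (L δ) (x + x) (g δ) ⟩
        t * (L δ + (x + x) * g δ)
          ≈⟨ *-congˡ (L+ δ) ⟩
        t * g (suc δ)
          ≈⟨ c₀ ⟨
        c 0
          ≈⟨ bottom ⟩
        1# + (x + x) * c 1 ∎)

  module Derivation (θ : Carrier → Carrier)
    (θ-cong : ∀ {a b} → a ≈ b → θ a ≈ θ b)
    (θ-+ : ∀ a b → θ (a + b) ≈ θ a + θ b)
    (θ-* : ∀ a b → θ (a * b) ≈ θ a * b + a * θ b)
    (θx≈x : θ x ≈ x) where

    θ1≈0 : θ 1# ≈ 0#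
    θ1≈0 = +-cancelʳ (θ 1#) _ _ (begin
      θ 1# + θ 1#             ≈⟨ +-cong (*-identityʳ _) (*-identityˡ _) ⟨
      θ 1# * 1# + 1# * θ 1#   ≈⟨ θ-* 1# 1# ⟨
      θ (1# * 1#)             ≈⟨ θ-cong (*-identityˡ 1#) ⟩
      θ 1#                    ≈⟨ +-identityˡ _ ⟨
      0# + θ 1#               ∎)

    -- Apply θ to `L-rec`. After x g₂ is expanded, its coefficient n + 3 exceeds that of x g₁ in
    -- `eq₁` by one and that of x² g₀ in x times `eq₀` by two. The surplus x g₁ - 2x² g₀ equals x
    -- l₀, the term that θ x = x produces in θ (x l₀).
    θL-step : ∀ n → θ (L n) + (suc n · 1#) * (x * g n) ≈ 0# →
              θ (L (suc n)) + (suc (suc n) · 1#) * (x * g (suc n)) ≈ 0# →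
              θ (L (suc (suc n))) + (suc (suc (suc n)) · 1#) * (x * g (suc (suc n))) ≈ 0#
    θL-step n eq₀ eq₁ = +-cancelʳ ((x * l₀ + x * θ l₀) + k₃ * (x * (x * g₀))) _ _ (begin
      (θ l₂ + k₃ * (x * g₂)) + ((x * l₀ + x * θ l₀) + k₃ * (x * (x * g₀)))
        ≈⟨ solve 6 (λ l l′ k x g₂ g₀ → (l :+ k :* (x :* g₂)) :+ (l′ :+ k :* (x :* (x :* g₀)))
             := (l :+ l′) :+ k :* (x :* (g₂ :+ x :* g₀))) refl (θ l₂) (x * l₀ + x * θ l₀) k₃ x g₂ g₀ ⟩
      (θ l₂ + (x * l₀ + x * θ l₀)) + k₃ * (x * (g₂ + x * g₀))
        ≈⟨ +-cong θl₁ (*-congˡ (*-congˡ (g-rec n))) ⟩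
      θ l₁ + (1# + k₂) * (x * g₁)
        ≈⟨ solve 4 (λ l k x g → l :+ (con 1 :+ k) :* (x :* g) := (l :+ k :* (x :* g)) :+ x :* g)
             refl (θ l₁) k₂ x g₁ ⟩
      (θ l₁ + k₂ * (x * g₁)) + x * g₁
        ≈⟨ +-cong eq₁ (*-congˡ (sym (L+ n))) ⟩
      0# + x * (l₀ + (x + x) * g₀)
        ≈⟨ +-congˡ (trans (sym (+-identityˡ _)) (+-congʳ (sym (trans (*-congˡ eq₀) (zeroʳ x))))) ⟩
      0# + (x * (θ l₀ + (suc n · 1#) * (x * g₀)) + x * (l₀ + (x + x) * g₀))
        ≈⟨ +-congˡ (solve 5 (λ l l′ k x g → x :* (l′ :+ k :* (x :* g)) :+ x :* (l :+ (x :+ x) :* g)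
             := (x :* l :+ x :* l′) :+ (con 1 :+ (con 1 :+ k)) :* (x :* (x :* g)))
             refl l₀ (θ l₀) (suc n · 1#) x g₀) ⟩
      0# + ((x * l₀ + x * θ l₀) + k₃ * (x * (x * g₀))) ∎)
      where
      g₀ = g n
      g₁ = g (suc n)
      g₂ = g (suc (suc n))
      l₀ = L n
      l₁ = L (suc n)
      l₂ = L (suc (suc n))
      k₂ = suc (suc n) · 1#
      k₃ = suc (suc (suc n)) · 1#
      θl₁ : θ l₂ + (x * l₀ + x * θ l₀) ≈ θ l₁
      θl₁ = begin
        θ l₂ + (x * l₀ + x * θ l₀)   ≈⟨ +-congˡ (+-congʳ (*-congʳ θx≈x)) ⟨
        θ l₂ + (θ x * l₀ + x * θ l₀) ≈⟨ +-congˡ (θ-* x l₀) ⟨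
        θ l₂ + θ (x * l₀)            ≈⟨ θ-+ _ _ ⟨
        θ (l₂ + x * l₀)              ≈⟨ θ-cong (L-rec n) ⟩
        θ l₁                         ∎

    θL : ∀ n → θ (L n) + (suc n · 1#) * (x * g n) ≈ 0#
    θL zero = begin
      θ (L 0) + (1 · 1#) * (x * 0#)  ≈⟨ +-cong (θ-cong L0≈1) (trans (*-congˡ (zeroʳ x)) (zeroʳ _)) ⟩
      θ 1# + 0#                      ≈⟨ trans (+-identityʳ _) θ1≈0 ⟩
      0#                             ∎
      where
      L0≈1 : L 0 ≈ 1#
      L0≈1 = trans (sym (trans (+-congˡ (zeroʳ _)) (+-identityʳ _))) (L+ 0)
    θL (suc zero) = begin
      θ (L 1) + (2 · 1#) * (x * 1#)
        ≈⟨ +-congˡ (solve 1 (λ x → (con 1 :+ (con 1 :+ con 0)) :* (x :* con 1) := x :+ x) refl x) ⟩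
      θ (L 1) + (x + x)
        ≈⟨ +-congˡ (trans (θ-+ x x) (+-cong θx≈x θx≈x)) ⟨
      θ (L 1) + θ (x + x)
        ≈⟨ θ-+ _ _ ⟨
      θ (L 1 + (x + x))
        ≈⟨ θ-cong L1 ⟩
      θ 1#
        ≈⟨ θ1≈0 ⟩
      0# ∎
      where
      L1 : L 1 + (x + x) ≈ 1#
      L1 = begin
        L 1 + (x + x)             ≈⟨ +-congˡ (*-identityʳ _) ⟨
        L 1 + (x + x) * g 1       ≈⟨ L+ 1 ⟩
        g 2                       ≈⟨ trans (+-congˡ (zeroʳ x)) (+-identityʳ _) ⟨
        g 2 + x * g 0             ≈⟨ g-rec 0 ⟩
        1#                        ∎
    θL (suc (suc n)) = θL-step n (θL n) (θL (suc n))

-- Deviation sets as walks in a strip.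

module Walks where
  open import Data.Integer.Base as ℤ using (ℤ; +_; -[1+_]; _⊖_; ∣_∣)
  open import Data.Nat.Base as ℕ using (_+_; _*_; _<_; _≤ᵇ_; z≤n)
  open import Data.Nat.Properties using (_≤?_)
  open import Relation.Binary.PropositionalEquality
    using (refl; sym; trans; cong; cong₂; subst; module ≡-Reasoning)

  private variable
    a p q : Level
    A B : Set a

  count-cong : {P : Pred A p} {Q : Pred A q} (P? : Decidable P) (Q? : Decidable Q) {xs : List A} →
               All (λ x → P x ⇔ Q x) xs → length (filter P? xs) ≡ length (filter Q? xs)
  count-cong P? Q? [] = refl
  count-cong P? Q? {x ∷ xs} (x⇔ ∷ xs⇔) with P? x
  ... | yes px = trans (cong suc (count-cong P? Q? xs⇔))
                       (sym (cong length (filter-accept Q? (Equivalence.to x⇔ px))))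
  ... | no ¬px = trans (count-cong P? Q? xs⇔)
                       (sym (cong length (filter-reject Q? (¬px ∘ Equivalence.from x⇔))))

  count-map : {P : Pred B p} (P? : Decidable P) (f : A → B) (xs : List A) →
              length (filter P? (map f xs)) ≡ length (filter (P? ∘ f) xs)
  count-map P? f []       = refl
  count-map P? f (x ∷ xs) with does (P? (f x))
  ... | true  = cong suc (count-map P? f xs)
  ... | false = count-map P? f xs

  compositions-sound : ∀ n → All (λ α → All NonZero α × sum α ≡ n) (compositions n)
  compositions-sound 0             = ([] , refl) ∷ []
  compositions-sound 1             = (_ ∷ [] , refl) ∷ []
  compositions-sound (suc (suc n)) = All.++⁺
    (All.map⁺ (All.map (λ (ps , s) → _ ∷ ps , cong suc s) (compositions-sound (suc n))))
    (All.map⁺ (All.map incHead⁺ (compositions-sound (suc n))))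
    where
    incHead⁺ : ∀ {α} → All NonZero α × sum α ≡ suc n →
               All NonZero (incHead α) × sum (incHead α) ≡ suc (suc n)
    incHead⁺ {[]}    (_ , ())
    incHead⁺ {_ ∷ _} (_ ∷ ps , s) = _ ∷ ps , cong suc s

  -- The walk starts at h and goes up first; flipping the sign after each run
  -- makes every run an upward one.
  Stays : ℕ → ℤ → List ℕ → Set
  Stays δ h []      = ∣ h ∣ ≤ 1
  Stays δ h (a ∷ α) = ∣ + a ℤ.+ h ∣ ≤ δ × Stays δ (ℤ.- (+ a ℤ.+ h)) α

  stays? : ∀ δ h → Decidable (Stays δ h)
  stays? δ h []      = ∣ h ∣ ≤? 1
  stays? δ h (a ∷ α) = (∣ + a ℤ.+ h ∣ ≤? δ) ×-dec stays? δ (ℤ.- (+ a ℤ.+ h)) α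

  -- The flip after a run and the sign change built into `altSum` negate the final height as a
  -- whole, which absolute values do not see.
  run-split : ∀ h a s → ∣ h ℤ.+ (+ a ℤ.- s) ∣ ≡ ∣ ℤ.- (+ a ℤ.+ h) ℤ.+ s ∣
  run-split h a s = trans (sym (ℤ.∣-i∣≡∣i∣ (h ℤ.+ (+ a ℤ.- s)))) (cong ∣_∣
    (solve 3 (λ h a s → :- (h :+ (a :- s)) := :- (a :+ h) :+ s) refl h (+ a) s))
    where open +-*-Solver

  stays⇒bounded : ∀ δ h α → ∣ h ∣ ≤ δ → Stays δ h α → ∀ j → ∣ h ℤ.+ altSum (take j α) ∣ ≤ δ
  stays⇒bounded δ h α       h≤ st zero    = subst (λ i → ∣ i ∣ ≤ δ) (sym (ℤ.+-identityʳ h)) h≤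
  stays⇒bounded δ h []      h≤ st (suc j) = subst (λ i → ∣ i ∣ ≤ δ) (sym (ℤ.+-identityʳ h)) h≤
  stays⇒bounded δ h (a ∷ α) h≤ (a+h≤ , st) (suc j) =
    subst (_≤ δ) (sym (run-split h a (altSum (take j α))))
      (stays⇒bounded δ _ α (subst (_≤ δ) (sym (ℤ.∣-i∣≡∣i∣ (+ a ℤ.+ h))) a+h≤) st j)

  stays⇒balanced : ∀ δ h α → Stays δ h α → ∣ h ℤ.+ altSum α ∣ ≤ 1
  stays⇒balanced δ h []      st       = subst (λ i → ∣ i ∣ ≤ 1) (sym (ℤ.+-identityʳ h)) st
  stays⇒balanced δ h (a ∷ α) (_ , st) =
    subst (_≤ 1) (sym (run-split h a (altSum α))) (stays⇒balanced δ _ α st)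

  bounded⇒stays : ∀ δ h α → (∀ j → 1 ≤ j → ∣ h ℤ.+ altSum (take j α) ∣ ≤ δ) →
                  ∣ h ℤ.+ altSum α ∣ ≤ 1 → Stays δ h α
  bounded⇒stays δ h []      bd bal = subst (λ i → ∣ i ∣ ≤ 1) (ℤ.+-identityʳ h) bal
  bounded⇒stays δ h (a ∷ α) bd bal =
    subst (λ i → ∣ i ∣ ≤ δ) (trans (cong (ℤ._+_ h) (ℤ.+-identityʳ (+ a))) (ℤ.+-comm h (+ a))) (bd 1 (s≤s z≤n)) ,
    bounded⇒stays δ _ α
      (λ j 1≤j → subst (_≤ δ) (run-split h a (altSum (take j α))) (bd (suc j) (s≤s z≤n)))
      (subst (_≤ 1) (run-split h a (altSum α)) bal)

  altSum≡odd⊖even : ∀ α → altSum α ≡ oddSum α ⊖ evenSum α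
  altSum≡odd⊖even []      = refl
  altSum≡odd⊖even (a ∷ α) = begin
    + a ℤ.- altSum α                 ≡⟨ cong (λ s → + a ℤ.- s) (altSum≡odd⊖even α) ⟩
    + a ℤ.- (oddSum α ⊖ evenSum α)   ≡⟨ cong (ℤ._+_ (+ a)) (ℤ.⊖-swap (evenSum α) (oddSum α)) ⟨
    + a ℤ.+ (evenSum α ⊖ oddSum α)   ≡⟨ ℤ.distribʳ-⊖-+-pos a (evenSum α) (oddSum α) ⟩
    (a + evenSum α) ⊖ oddSum α       ∎
    where open ≡-Reasoning

  ∣m⊖n∣≡∣m-n∣ : ∀ m n → ∣ m ⊖ n ∣ ≡ ℕ.∣ m - n ∣
  ∣m⊖n∣≡∣m-n∣ zero    zero    = refl
  ∣m⊖n∣≡∣m-n∣ zero    (suc n) = refl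
  ∣m⊖n∣≡∣m-n∣ (suc m) zero    = refl
  ∣m⊖n∣≡∣m-n∣ (suc m) (suc n) = trans (cong ∣_∣ (ℤ.[1+m]⊖[1+n]≡m⊖n m n)) (∣m⊖n∣≡∣m-n∣ m n)

  ∣altSum∣ : ∀ α → ∣ altSum α ∣ ≡ ℕ.∣ oddSum α - evenSum α ∣
  ∣altSum∣ α = trans (cong ∣_∣ (altSum≡odd⊖even α)) (∣m⊖n∣≡∣m-n∣ (oddSum α) (evenSum α))

  deviationSet⇔stays : ∀ m δ {α} → All NonZero α × sum α ≡ m →
                       IsDeviationSet m δ α ⇔ Stays δ ℤ.0ℤ α
  deviationSet⇔stays m δ {α} (ps , s) = mk⇔
    (λ dev → let open IsDeviationSet dev in
      bounded⇒stays δ ℤ.0ℤ α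
        (λ j 1≤j → subst (λ i → ∣ i ∣ ≤ δ) (sym (ℤ.+-identityˡ (altSum (take j α)))) (bounded j 1≤j))
        (subst (_≤ 1) (sym (trans (cong ∣_∣ (ℤ.+-identityˡ (altSum α))) (∣altSum∣ α))) balanced))
    (λ st → record
      { positive = ps
      ; size     = s
      ; balanced = subst (_≤ 1) (trans (cong ∣_∣ (ℤ.+-identityˡ (altSum α))) (∣altSum∣ α))
                     (stays⇒balanced δ ℤ.0ℤ α st)
      ; bounded  = λ j _ → subst (λ i → ∣ i ∣ ≤ δ) (ℤ.+-identityˡ (altSum (take j α)))
                     (stays⇒bounded δ ℤ.0ℤ α z≤n st j)
      })

  ζ≡count-stays : ∀ m δ → ζ m δ ≡ length (filter (stays? δ ℤ.0ℤ) (compositions m))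
  ζ≡count-stays m δ = count-cong _ (stays? δ ℤ.0ℤ)
    (All.map (deviationSet⇔stays m δ) (compositions-sound m))

  -- Walks of length m from height k, or by symmetry from -k, that stay in
  -- [-δ, δ] and end in {-1, 0, 1}.
  walks : (δ m k : ℕ) → ℕ
  walks δ zero    k       = if (k ≤ᵇ δ) ∧ (k ≤ᵇ 1) then 1 else 0
  walks δ (suc m) zero    = walks δ m 1 + walks δ m 1
  walks δ (suc m) (suc k) = if suc k ≤ᵇ δ then walks δ m k + walks δ m (suc (suc k)) else 0

  ≤⇒≤ᵇ-true : ∀ {m n} → m ≤ n → (m ≤ᵇ n) ≡ true
  ≤⇒≤ᵇ-true {m} {n} m≤n with m ≤ᵇ n | ℕ.≤⇒≤ᵇ m≤n
  ... | true | _ = refl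

  >⇒≤ᵇ-false : ∀ {m n} → n < m → (m ≤ᵇ n) ≡ false
  >⇒≤ᵇ-false {m} {n} n<m with m ≤ᵇ n | ℕ.≤ᵇ⇒≤ m n
  ... | true  | m≤n = ⊥-elim (ℕ.<⇒≱ n<m (m≤n _))
  ... | false | _   = refl

  walks-> : ∀ {δ} m {k} → δ < k → walks δ m k ≡ 0
  walks-> zero    {k} δ<k     rewrite >⇒≤ᵇ-false δ<k = refl
  walks-> (suc m) {suc k} δ<k rewrite >⇒≤ᵇ-false δ<k = refl

  walks-suc : ∀ {δ} m {k} → suc k ≤ δ → walks δ (suc m) (suc k) ≡ walks δ m k + walks δ m (suc (suc k))
  walks-suc m k<δ rewrite ≤⇒≤ᵇ-true k<δ = refl

  count : (δ : ℕ) → ℤ → ℕ → ℕ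
  count δ h m = length (filter (stays? δ h) (compositions m))

  -- The first step reaches 1 + h. Either the run ends there, and the rest is flipped, or it goes
  -- on, and what remains is a walk from 1 + h with its first run one shorter. These are the two
  -- halves of `compositions`; the bound is what the ended run must satisfy.
  count-split : ∀ {δ h} m → ∣ + 1 ℤ.+ h ∣ ≤ δ →
    count δ h (suc (suc m)) ≡ count δ (ℤ.- (+ 1 ℤ.+ h)) (suc m) + count δ (+ 1 ℤ.+ h) (suc m)
  count-split {δ} {h} m h≤ = begin
    length (filter (stays? δ h) (map (1 ∷_) cs ++ map incHead cs))
      ≡⟨ cong length (filter-++ (stays? δ h) (map (1 ∷_) cs) _) ⟩
    length (filter (stays? δ h) (map (1 ∷_) cs) ++ filter (stays? δ h) (map incHead cs))
      ≡⟨ length-++ (filter (stays? δ h) (map (1 ∷_) cs)) ⟩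
    length (filter (stays? δ h) (map (1 ∷_) cs)) + length (filter (stays? δ h) (map incHead cs))
      ≡⟨ cong₂ _+_ (count-map (stays? δ h) (1 ∷_) cs) (count-map (stays? δ h) incHead cs) ⟩
    length (filter (stays? δ h ∘ (1 ∷_)) cs) + length (filter (stays? δ h ∘ incHead) cs)
      ≡⟨ cong₂ _+_
           (count-cong (stays? δ h ∘ (1 ∷_)) (stays? δ (ℤ.- (+ 1 ℤ.+ h)))
             (All.universal (λ β → mk⇔ proj₂ (h≤ ,_)) cs))
           (count-cong (stays? δ h ∘ incHead) (stays? δ (+ 1 ℤ.+ h))
             (All.map longer (compositions-sound (suc m)))) ⟩
    count δ (ℤ.- (+ 1 ℤ.+ h)) (suc m) + count δ (+ 1 ℤ.+ h) (suc m) ∎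
    where
    open ≡-Reasoning
    cs = compositions (suc m)
    longer : ∀ {β} → All NonZero β × sum β ≡ suc m → Stays δ h (incHead β) ⇔ Stays δ (+ 1 ℤ.+ h) β
    longer {[]}    (_ , ())
    longer {a ∷ β} _ = mk⇔ (subst Rest eq) (subst Rest (sym eq))
      where
      Rest : ℤ → Set
      Rest i = ∣ i ∣ ≤ δ × Stays δ (ℤ.- i) β
      eq : + suc a ℤ.+ h ≡ + a ℤ.+ (+ 1 ℤ.+ h)
      eq = trans (cong (λ n → + n ℤ.+ h) (ℕ.+-comm 1 a)) (ℤ.+-assoc (+ a) (+ 1) h)

  -- The first run has at least one step and only climbs, so it already ends above δ.
  count-above : ∀ {δ n} m → δ < suc n → count δ (+ n) (suc m) ≡ 0
  count-above {δ} {n} m δ<n =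
    cong length (filter-none (stays? δ (+ n)) (All.map leaves (compositions-sound (suc m))))
    where
    leaves : ∀ {α} → All NonZero α × sum α ≡ suc m → ¬ Stays δ (+ n) α
    leaves {[]}        (_ , ())
    leaves {suc a ∷ α} (_ ∷ _ , _) (a+n≤δ , _) = ℕ.<⇒≱ δ<n (ℕ.≤-trans (s≤s (ℕ.m≤n+m n a)) a+n≤δ)

  -- Excludes starts so far below -δ that the first step lands outside the strip: a long first run
  -- could climb back in and be accepted by `Stays`, which looks only at run ends, while `walks`
  -- gives 0.
  NotBelow : ℕ → ℤ → Set
  NotBelow δ (+ _)    = ⊤
  NotBelow δ -[1+ n ] = suc n ≤ δ

  ∣1⊖1+n∣≡n : ∀ n → ∣ 1 ⊖ suc n ∣ ≡ n
  ∣1⊖1+n∣≡n n = ∣m⊖n∣≡∣m-n∣ 1 (suc n)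

  -- The upward first step is forced and hence removed, leaving m steps from 1 + h. Since `walks`
  -- takes the distance from 0, the flip in `count-split` is harmless.
  count≡walks : ∀ {δ} m h → NotBelow δ h → count δ h (suc m) ≡ walks δ m ∣ + 1 ℤ.+ h ∣
  count≡walks {δ} zero h _ rewrite ℤ.∣-i∣≡∣i∣ (+ 1 ℤ.+ h)
    with (∣ + 1 ℤ.+ h ∣ ≤ᵇ δ) ∧ (∣ + 1 ℤ.+ h ∣ ≤ᵇ 1)
  ... | true  = refl
  ... | false = refl
  count≡walks {δ} (suc m) (+ n) _ with suc n ≤? δ
  ... | yes n<δ = begin
    count δ (+ n) (suc (suc m))
      ≡⟨ count-split m n<δ ⟩
    count δ -[1+ n ] (suc m) + count δ (+ suc n) (suc m)
      ≡⟨ cong₂ _+_ (count≡walks m -[1+ n ] n<δ) (count≡walks m (+ suc n) _) ⟩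
    walks δ m ∣ 1 ⊖ suc n ∣ + walks δ m (suc (suc n))
      ≡⟨ cong (λ k → walks δ m k + walks δ m (suc (suc n))) (∣1⊖1+n∣≡n n) ⟩
    walks δ m n + walks δ m (suc (suc n))
      ≡⟨ walks-suc m n<δ ⟨
    walks δ (suc m) (suc n) ∎
    where open ≡-Reasoning
  ... | no n≮δ = trans (count-above (suc m) (ℕ.≰⇒> n≮δ)) (sym (walks-> (suc m) (ℕ.≰⇒> n≮δ)))
  -- The first step lands on 0, where ending the run and continuing it are mirror images; hence the
  -- doubling in `walks` at height 0.
  count≡walks {δ} (suc m) -[1+ zero ] _ =
    trans (count-split m z≤n) (cong₂ _+_ (count≡walks m (+ 0) _) (count≡walks m (+ 0) _))
  count≡walks {δ} (suc m) -[1+ suc j ] j+1<δ = begin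
    count δ -[1+ suc j ] (suc (suc m))
      ≡⟨ count-split m j<δ ⟩
    count δ (+ suc j) (suc m) + count δ -[1+ j ] (suc m)
      ≡⟨ cong₂ _+_ (count≡walks m (+ suc j) _) (count≡walks m -[1+ j ] j<δ) ⟩
    walks δ m (suc (suc j)) + walks δ m ∣ 1 ⊖ suc j ∣
      ≡⟨ cong (λ k → walks δ m (suc (suc j)) + walks δ m k) (∣1⊖1+n∣≡n j) ⟩
    walks δ m (suc (suc j)) + walks δ m j
      ≡⟨ ℕ.+-comm (walks δ m (suc (suc j))) _ ⟩
    walks δ m j + walks δ m (suc (suc j))
      ≡⟨ walks-suc m j<δ ⟨
    walks δ (suc m) (suc j) ∎
    where
    open ≡-Reasoning
    j<δ : suc j ≤ δ
    j<δ = ℕ.≤-trans (ℕ.n≤1+n _) j+1<δ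

  ζ≡walks : ∀ m δ → ζ (suc m) δ ≡ walks δ m 1
  ζ≡walks m δ = trans (ζ≡count-stays (suc m) δ) (count≡walks m (+ 0) _)

  -- Parity and the recurrences for returns to 0.

  walks-far : ∀ {δ} m {k} → suc m < k → walks δ m k ≡ 0
  walks-far {δ} zero {suc (suc k)} (s≤s (s≤s _)) with suc (suc k) ≤ᵇ δ
  ... | true  = refl
  ... | false = refl
  walks-far {δ} (suc m) {suc k} (s≤s m<k) with suc k ≤ᵇ δ
  ... | true  = cong₂ _+_ (walks-far m m<k) (walks-far m (ℕ.≤-trans m<k (ℕ.≤-trans (ℕ.n≤1+n _) (ℕ.n≤1+n _))))
  ... | false = refl

  -- From a height of the parity of m + 1 a walk of length m ends at ±1, and its
  -- extension ending at 0 is unique.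
  walks-odd : ∀ {δ} .{{_ : NonZero δ}} m {k} n → m + k ≡ suc (n * 2) → walks δ (suc m) k ≡ walks δ m k
  walks-odd {suc δ} zero {1} zero refl = cong suc (walks-far {suc δ} 0 ℕ.≤-refl)
  walks-odd {δ} zero {suc (suc (suc k))} (suc n) eq with suc (suc (suc k)) ≤ᵇ δ
  ... | true  = cong₂ _+_ (walks-far {δ} 0 {suc (suc k)} (s≤s (s≤s z≤n))) (walks-far {δ} 0 {4 + k} (s≤s (s≤s z≤n)))
  ... | false = refl
  walks-odd {δ} (suc m) {zero} n eq = cong₂ _+_ ih ih
    where
    ih : walks δ (suc m) 1 ≡ walks δ m 1
    ih = walks-odd m n (trans (ℕ.+-comm m 1) (trans (cong suc (sym (ℕ.+-identityʳ m))) eq))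
  walks-odd {δ} (suc m) {suc k} zero eq with () ← trans (sym (ℕ.+-suc m k)) (ℕ.suc-injective eq)
  walks-odd {δ} (suc m) {suc k} (suc n) eq with suc k ≤ᵇ δ
  ... | false = refl
  ... | true  = cong₂ _+_ (walks-odd m n m+k) (walks-odd m (suc n) m+k+2)
    where
    m+k : m + k ≡ suc (n * 2)
    m+k = ℕ.suc-injective (trans (sym (ℕ.+-suc m k)) (ℕ.suc-injective eq))
    m+k+2 : m + suc (suc k) ≡ suc (suc n * 2)
    m+k+2 = trans (ℕ.+-suc m (suc k)) eq

  -- For odd m the two lengths coincide; for even m the walk ends at 1 or -1 and `walks-odd`
  -- supplies the missing step.
  walks-1 : ∀ {δ} .{{_ : NonZero δ}} m → walks δ m 1 ≡ walks δ (⌊ m /2⌋ * 2 + 1) 1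
  walks-1 {δ} m with parity m
    where
    parity : ∀ m → m ≡ ⌊ m /2⌋ * 2 ⊎ m ≡ suc (⌊ m /2⌋ * 2)
    parity 0 = inj₁ refl
    parity 1 = inj₂ refl
    parity (suc (suc m)) = Sum.map (cong (_+_ 2)) (cong (_+_ 2)) (parity m)
  ... | inj₁ even = begin
    walks δ m 1             ≡⟨ walks-odd m ⌊ m /2⌋ (trans (ℕ.+-comm m 1) (cong suc even)) ⟨
    walks δ (suc m) 1       ≡⟨ cong (λ n → walks δ n 1) (trans (cong suc even) (ℕ.+-comm 1 _)) ⟩
    walks δ (⌊ m /2⌋ * 2 + 1) 1 ∎
    where open ≡-Reasoning
  ... | inj₂ odd = cong (λ n → walks δ n 1) (trans odd (ℕ.+-comm 1 _))

  -- By parity these walks end at 0.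
  returns : (δ k n : ℕ) → ℕ
  returns δ k n = walks δ (n * 2 + k) k

  returns-top : ∀ δ n → returns δ (suc δ) n ≡ 0
  returns-top δ n = walks-> (n * 2 + suc δ) ℕ.≤-refl

  returns-0 : ∀ δ n → returns δ 0 (suc n) ≡ returns δ 1 n + returns δ 1 n
  returns-0 δ n = cong₂ _+_ eq eq
    where
    eq : walks δ (suc (n * 2 + 0)) 1 ≡ returns δ 1 n
    eq = cong (λ m → walks δ m 1) (sym (ℕ.+-suc (n * 2) 0))

  -- With k + 1 steps to descend k + 1 levels there is no room for a step up.
  returns-suc-0 : ∀ {δ} k → suc k ≤ δ → returns δ (suc k) 0 ≡ returns δ k 0
  returns-suc-0 {δ} k k<δ = begin
    walks δ (suc k) (suc k)               ≡⟨ walks-suc k k<δ ⟩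
    walks δ k k + walks δ k (suc (suc k)) ≡⟨ cong (_+_ (walks δ k k)) (walks-far k ℕ.≤-refl) ⟩
    walks δ k k + 0                       ≡⟨ ℕ.+-identityʳ _ ⟩
    walks δ k k                           ∎
    where open ≡-Reasoning

  -- A step down leaves 2(n + 1) + k steps, a step up 2n + (k + 2). The up-step costs one unit of
  -- the index, hence the factor x in the recurrence of the series.
  returns-suc-suc : ∀ {δ} k n → suc k ≤ δ →
                    returns δ (suc k) (suc n) ≡ returns δ k (suc n) + returns δ (suc (suc k)) n
  returns-suc-suc {δ} k n k<δ = trans (walks-suc (suc (n * 2 + suc k)) k<δ)
    (cong₂ _+_ (cong (λ m → walks δ (suc m) k) (ℕ.+-suc (n * 2) k))
               (cong (λ m → walks δ m (suc (suc k))) (sym (ℕ.+-suc (n * 2) (suc k)))))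

  ζ≡returns : ∀ m δ .{{_ : NonZero δ}} → ζ (suc m) δ ≡ returns δ 1 ⌊ m /2⌋
  ζ≡returns m δ = trans (ζ≡walks m δ) (walks-1 m)

-- From polynomials over the field to series, and the power sums of the roots.

module Roots {c ℓ₁ ℓ₂ : Level} (K : HeytingField c ℓ₁ ℓ₂) (char0 : CharacteristicZero K) where
  open CharZeroField K char0
  open CommutativeRing commutativeRing
    hiding (zero; Carrier; _≈_; _+_; _*_; -_; _-_; 0#; 1#; rawRing)
  open Walks using (returns; returns-top; returns-0; returns-suc-0; returns-suc-suc; ζ≡returns)
  open HeytingProperties heytingCommutativeRing using (x-0≈x; invertibleˡ⇒#)
  open SemiringMult semiring using (×-homo-+)
  open RingProperties ring using (-‿distribˡ-*; -‿distribʳ-*; -0#≈0#)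
  open SemiringSolver commutativeSemiring using (solve; _:+_; _:*_; _:=_; con)
  module K-Reasoning = SetoidReasoning setoid

  module S where
    open PowerSeries commutativeRing public
    private
      module R = CommutativeRing seriesRing
    open R public
      using (refl; sym; trans; +-cong; +-congˡ; +-congʳ; *-congˡ; *-congʳ; +-identityʳ
            ; distribʳ; 0#; 1#; -_; zeroʳ; -‿cong)
    open RingProperties R.ring public using (-‿distribˡ-*; -‿distribʳ-*; -‿involutive; +-cancelʳ)
    open SemiringMult R.semiring public using () renaming (_×_ to _·_)
    open SemiringSolver R.commutativeSemiring public using (solve; _:+_; _:*_; _:=_)
    module Reasoning = SetoidReasoning R.setoid
    open Lucas seriesRing x public
  open S using (Series; _≈ˢ_; _⊕_; _⊛_; const; θ; g; L)

  coeff-+ : ∀ f h → coeff (f +ₚ h) ≈ˢ coeff f ⊕ coeff h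
  coeff-+ []      h       n       = sym (+-identityˡ _)
  coeff-+ (a ∷ f) []      n       = sym (+-identityʳ _)
  coeff-+ (a ∷ f) (b ∷ h) zero    = refl
  coeff-+ (a ∷ f) (b ∷ h) (suc n) = coeff-+ f h n

  coeff-neg : ∀ f → coeff (-ₚ f) ≈ˢ S.- coeff f
  coeff-neg []      n       = sym -0#≈0#
  coeff-neg (a ∷ f) zero    = refl
  coeff-neg (a ∷ f) (suc n) = coeff-neg f n

  coeff-scale : ∀ a f n → coeff (map (a *_) f) n ≈ a * coeff f n
  coeff-scale a []      n       = sym (zeroʳ a)
  coeff-scale a (b ∷ f) zero    = refl
  coeff-scale a (b ∷ f) (suc n) = coeff-scale a f n

  coeff-* : ∀ f h → coeff (f *ₚ h) ≈ˢ coeff f ⊛ coeff h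
  coeff-* []      h n = sym (S.⊛-zeroˡ (coeff h) n)
  coeff-* (a ∷ f) h n = trans (coeff-+ (map (a *_) h) (0# ∷ f *ₚ h) n)
                              (trans (+-congʳ (coeff-scale a h n)) (shift n))
    where
    shift : ∀ n → a * coeff h n +ᴷ coeff (0# ∷ f *ₚ h) n ≈ (coeff (a ∷ f) ⊛ coeff h) n
    shift zero    = +-identityʳ _
    shift (suc n) = +-congˡ (coeff-* f h n)

  coeff-C : ∀ a → coeff (C a) ≈ˢ const a
  coeff-C a zero    = refl
  coeff-C a (suc n) = refl

  coeff-X : coeff X ≈ˢ S.x
  coeff-X zero          = refl
  coeff-X (suc zero)    = refl
  coeff-X (suc (suc n)) = refl

  D : Series
  D = coeff 1-4X

  D+4x≈1 : D ⊕ ((S.x ⊕ S.x) ⊕ (S.x ⊕ S.x)) ≈ˢ const 1#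
  D+4x≈1 n = begin
    coeff 1-4X n +ᴷ ((y +ᴷ y) +ᴷ (y +ᴷ y))
      ≈⟨ +-congʳ (trans (coeff-+ (C 1#) (-ₚ (C (fromℕ 4) *ₚ X)) n) (+-congˡ (coeff-neg (C (fromℕ 4) *ₚ X) n))) ⟩
    (coeff (C 1#) n +ᴷ - coeff (C (fromℕ 4) *ₚ X) n) +ᴷ ((y +ᴷ y) +ᴷ (y +ᴷ y))
      ≈⟨ +-cong (+-congʳ (coeff-C 1# n)) (sym 4X) ⟩
    (const 1# n +ᴷ - coeff (C (fromℕ 4) *ₚ X) n) +ᴷ coeff (C (fromℕ 4) *ₚ X) n
      ≈⟨ trans (+-assoc _ _ _) (trans (+-congˡ (-‿inverseˡ _)) (+-identityʳ _)) ⟩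
    const 1# n ∎
    where
    open K-Reasoning
    y = S.x n
    4X : coeff (C (fromℕ 4) *ₚ X) n ≈ (y +ᴷ y) +ᴷ (y +ᴷ y)
    4X = begin
      coeff (C (fromℕ 4) *ₚ X) n     ≈⟨ coeff-* (C (fromℕ 4)) X n ⟩
      (coeff (C (fromℕ 4)) ⊛ coeff X) n ≈⟨ S.⊛-cong (coeff-C (fromℕ 4)) coeff-X n ⟩
      (const (fromℕ 4) ⊛ S.x) n      ≈⟨ S.const-⊛ (fromℕ 4) S.x n ⟩
      fromℕ 4 * y
        ≈⟨ solve 1 (λ y → (con 1 :+ (con 1 :+ (con 1 :+ (con 1 :+ con 0)))) :* y := (y :+ y) :+ (y :+ y)) refl y ⟩
      (y +ᴷ y) +ᴷ (y +ᴷ y)           ∎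

  inv-inverseˡ : ∀ a (a#0 : a # 0#) → inv a a#0 * a ≈ 1#
  inv-inverseˡ a a#0 = trans (*-congˡ (sym (x-0≈x a))) (proj₁ (proj₂ (#⇒invertible a#0)))

  h : Series
  h = const (1/ 2)

  h+h≈1 : h ⊕ h ≈ˢ const 1#
  h+h≈1 zero    = begin
    1/ 2 +ᴷ 1/ 2
      ≈⟨ solve 1 (λ y → y :+ y := y :* (con 1 :+ (con 1 :+ con 0))) refl (1/ 2) ⟩
    1/ 2 * fromℕ 2
      ≈⟨ inv-inverseˡ (fromℕ 2) (char0 2) ⟩
    1# ∎
    where open K-Reasoning
  h+h≈1 (suc n) = +-identityˡ 0#

  open S.Binet h D h+h≈1 D+4x≈1

  private
    module Q = RawSemiringDefinitions (RawRing.rawSemiring (quadraticExtension polyRing 1-4X))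

  IsPower : Series → ℕ → Poly × Poly → Set ℓ₁
  IsPower e n (a , b) = (coeff a ≈ˢ rational n) × (coeff b ≈ˢ e ⊛ g n)

  -- e = h for u and e = -h for v
  isPower : ∀ k e → coeff (C k) ≈ˢ e → (∀ a → e ⊛ (e ⊛ a) ≈ˢ h ⊛ (h ⊛ a)) →
            ∀ n → IsPower e n ((C (1/ 2) , C k) Q.^ n)
  isPower k e k≈e ee≈hh zero    =
    S.trans (coeff-C 1#) (λ n → sym (trans (+-congˡ (trans (-‿cong (S.zeroʳ h n)) -0#≈0#)) (+-identityʳ _))) ,
    S.sym (S.zeroʳ e)
  isPower k e k≈e ee≈hh (suc n) with (C (1/ 2) , C k) Q.^ n | isPower k e k≈e ee≈hh n
  ... | a , b | a≈ , b≈ =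
    (begin
      coeff (C (1/ 2) *ₚ a +ₚ 1-4X *ₚ (C k *ₚ b))
        ≈⟨ coeff-+ (C (1/ 2) *ₚ a) _ ⟩
      coeff (C (1/ 2) *ₚ a) ⊕ coeff (1-4X *ₚ (C k *ₚ b))
        ≈⟨ S.+-cong (S.trans (coeff-* (C (1/ 2)) a) (S.⊛-cong (coeff-C (1/ 2)) a≈))
             (S.trans (coeff-* 1-4X (C k *ₚ b)) (S.⊛-cong {D} (λ _ → refl)
               -- The sign of e disappears here: e enters the rational part only through its square.
               (S.trans (S.trans (coeff-* (C k) b) (S.⊛-cong k≈e b≈)) (ee≈hh (g n))))) ⟩
      (h ⊛ rational n) ⊕ (D ⊛ (h ⊛ (h ⊛ g n)))
        ≈⟨ rational-suc n ⟩
      rational (suc n) ∎) ,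
    (begin
      coeff (C (1/ 2) *ₚ b +ₚ C k *ₚ a)
        ≈⟨ coeff-+ (C (1/ 2) *ₚ b) _ ⟩
      coeff (C (1/ 2) *ₚ b) ⊕ coeff (C k *ₚ a)
        ≈⟨ S.+-cong (S.trans (coeff-* (C (1/ 2)) b) (S.⊛-cong (coeff-C (1/ 2)) b≈))
                    (S.trans (coeff-* (C k) a) (S.⊛-cong k≈e a≈)) ⟩
      (h ⊛ (e ⊛ g n)) ⊕ (e ⊛ rational n)
        ≈⟨ S.solve 4 (λ h e g r → h S.:* (e S.:* g) S.:+ e S.:* r S.:= e S.:* (r S.:+ h S.:* g))
             (λ _ → refl) h e (g n) (rational n) ⟩
      e ⊛ (rational n ⊕ (h ⊛ g n))
        ≈⟨ S.*-congˡ {e} (rational+ n) ⟩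
      e ⊛ g (suc n) ∎)
    where open S.Reasoning

  -- Eliminates √(1 - 4X): beyond this point `p` is used only as a Lucas series.
  p≈L : ∀ δ → coeff (p δ) ≈ˢ L δ
  p≈L δ = begin
    coeff (p δ)
      ≈⟨ coeff-+ (proj₁ (u Q.^ suc δ)) (proj₁ (v Q.^ suc δ)) ⟩
    coeff (proj₁ (u Q.^ suc δ)) ⊕ coeff (proj₁ (v Q.^ suc δ))
      ≈⟨ S.+-cong (proj₁ (isPower (1/ 2) h (coeff-C _) (λ a → S.refl) (suc δ)))
                  (proj₁ (isPower (- (1/ 2)) (S.- h) -½ (λ a → [-h]²) (suc δ))) ⟩
    rational (suc δ) ⊕ rational (suc δ)
      ≈⟨ rational≈L δ ⟩
    L δ ∎
    where
    open S.Reasoning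
    -½ : coeff (C (- (1/ 2))) ≈ˢ S.- h
    -½ zero    = refl
    -½ (suc n) = sym -0#≈0#
    [-h]² : ∀ {a} → (S.- h) ⊛ ((S.- h) ⊛ a) ≈ˢ h ⊛ (h ⊛ a)
    [-h]² {a} = begin
      (S.- h) ⊛ ((S.- h) ⊛ a)   ≈⟨ S.*-congˡ {S.- h} (S.-‿distribˡ-* h a) ⟨
      (S.- h) ⊛ (S.- (h ⊛ a))   ≈⟨ S.-‿distribˡ-* h (S.- (h ⊛ a)) ⟨
      S.- (h ⊛ (S.- (h ⊛ a)))   ≈⟨ S.-‿cong (S.-‿distribʳ-* h (h ⊛ a)) ⟨
      S.- (S.- (h ⊛ (h ⊛ a)))   ≈⟨ S.-‿involutive _ ⟩
      h ⊛ (h ⊛ a)               ∎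

  n·0≈0 : ∀ n → n · 0# ≈ 0#
  n·0≈0 zero    = refl
  n·0≈0 (suc n) = trans (+-identityˡ _) (n·0≈0 n)

  θx≈x : θ S.x ≈ˢ S.x
  θx≈x zero          = refl
  θx≈x (suc zero)    = +-identityʳ _
  θx≈x (suc (suc n)) = n·0≈0 (suc (suc n))

  θ-const : ∀ k → θ (const k) ≈ˢ S.0#
  θ-const k zero    = refl
  θ-const k (suc n) = n·0≈0 (suc n)

  ·1≈const : ∀ n → n S.· S.1# ≈ˢ const (fromℕ n)
  ·1≈const n       zero    = scalar n
    where
    scalar : ∀ n → (n S.· S.1#) 0 ≈ fromℕ n
    scalar zero    = refl
    scalar (suc n) = +-congˡ (scalar n)
  ·1≈const zero    (suc i) = refl
  ·1≈const (suc n) (suc i) = trans (+-identityˡ _) (·1≈const n (suc i))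

  open S.Derivation θ S.θ-cong S.θ-⊕ S.θ-⊛ θx≈x using (θL)

  module _ (δ : ℕ) where

    returnSeries : ℕ → Series
    returnSeries k n = fromℕ (returns δ k n)

    fromℕ-≡ : ∀ {m n} → m ≡ n → fromℕ m ≈ fromℕ n
    fromℕ-≡ eq = reflexive (≡.cong fromℕ eq)

    top : returnSeries (suc δ) ≈ˢ S.0#
    top n = fromℕ-≡ (returns-top δ n)

    middle : ∀ k → suc k ≤ δ →
             returnSeries (suc k) ≈ˢ returnSeries k ⊕ (S.x ⊛ returnSeries (suc (suc k)))
    middle k k<δ zero    = trans (fromℕ-≡ (returns-suc-0 k k<δ))
      (sym (trans (+-congˡ (zeroˡ _)) (+-identityʳ _)))
    middle k k<δ (suc n) = trans (fromℕ-≡ (returns-suc-suc k n k<δ))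
      (trans (×-homo-+ 1# (returns δ k (suc n)) _)
        (+-congˡ (sym (S.x-⊛-suc (returnSeries (suc (suc k))) n))))

    bottom : returnSeries 0 ≈ˢ S.1# ⊕ ((S.x ⊕ S.x) ⊛ returnSeries 1)
    bottom zero    = +-congˡ (sym (trans (*-congʳ (+-identityˡ 0#)) (zeroˡ _)))
    bottom (suc n) = trans (fromℕ-≡ (returns-0 δ n))
      (trans (×-homo-+ 1# (returns δ 1 n) _)
        (sym (trans (+-identityˡ _) (trans (S.distribʳ (returnSeries 1) S.x S.x (suc n))
          (+-cong (S.x-⊛-suc (returnSeries 1) n) (S.x-⊛-suc (returnSeries 1) n))))))

    open S.Chain δ returnSeries top middle bottom public using (c₁*L)

  g₀≈1 : ∀ n → g (suc n) 0 ≈ 1#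
  g₀≈1 zero    = refl
  g₀≈1 (suc n) = trans (sym (+-identityʳ _)) (trans (+-congˡ (sym (zeroˡ _))) (trans (S.g-rec n 0) (g₀≈1 n)))

  -- At x = 0 the numbers u and v are 1 and 0. This is used twice, to cancel `L δ` and to invert the
  -- roots.
  L₀≈1 : ∀ n → L n 0 ≈ 1#
  L₀≈1 n = trans (sym (+-identityʳ _))
    (trans (+-congˡ (sym (trans (*-congʳ (+-identityˡ 0#)) (zeroˡ _)))) (trans (S.L+ n 0) (g₀≈1 n)))

  linear : Carrier → Poly
  linear a = X +ₚ -ₚ C a

  private
    module P = RawSemiringDefinitions (RawRing.rawSemiring polyRing)

  nonzero : ∀ {a b} → b * a ≈ 1# → a # 0#
  nonzero {a} {b} ba≈1 = invertibleˡ⇒# (b , trans (*-congˡ (x-0≈x a)) ba≈1)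

  -- Apartness from 0 is obtained from an explicit inverse. The constant term of the product is ∏
  -- (-ϑᵢ), so the cofactor of each ϑᵢ in the equation inverts it. k is arbitrary so that the
  -- induction can absorb the factors already split off.
  roots-nonzero : ∀ {d} (ϑ : Vector Carrier d) k →
                  k * coeff (P.product (linear ∘ ϑ)) 0 ≈ 1# → ∀ i → ϑ i # 0#
  roots-nonzero {suc d} ϑ k eq = λ where
      zero    → nonzero {b = - (k * r)} (trans sign-out eq′)
      (suc i) → roots-nonzero (ϑ ∘ suc) (k * - ϑ₀) (trans (*-assoc _ _ _) eq′) i
    where
    open K-Reasoning
    ϑ₀ = ϑ zero
    r  = coeff (P.product (linear ∘ ϑ ∘ suc)) 0
    eq′ : k * (- ϑ₀ * r) ≈ 1#
    eq′ = begin
      k * (- ϑ₀ * r)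
        ≈⟨ *-congˡ (*-congʳ (+-identityˡ _)) ⟨
      k * ((0# +ᴷ - ϑ₀) * r)
        ≈⟨ *-congˡ (coeff-* (linear ϑ₀) (P.product (linear ∘ ϑ ∘ suc)) 0) ⟨
      k * coeff (P.product (linear ∘ ϑ)) 0
        ≈⟨ eq ⟩
      1# ∎
    sign-out : - (k * r) * ϑ₀ ≈ k * (- ϑ₀ * r)
    sign-out = begin
      - (k * r) * ϑ₀     ≈⟨ -‿distribˡ-* (k * r) ϑ₀ ⟨
      - (k * r * ϑ₀)     ≈⟨ -‿distribʳ-* (k * r) ϑ₀ ⟩
      k * r * - ϑ₀       ≈⟨ *-assoc _ _ _ ⟩
      k * (r * - ϑ₀)     ≈⟨ *-congˡ (*-comm _ _) ⟩
      k * (- ϑ₀ * r)     ∎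

  -- The series yx / (1 - yx). The constant term is 0 rather than y⁰, since for a = 1/y it equals
  -- -θ(x - a) / (x - a) and θ kills constant terms.
  powers : Carrier → Series
  powers y zero    = 0#
  powers y (suc n) = y ^ suc n

  powerSums : ∀ {d} → Vector Carrier d → Series
  powerSums y n = Σ (λ i → powers (y i) n)

  -- θ a ⊕ (a ⊛ s) ≈ 0 says that -s is the logarithmic derivative θa / a.
  θ-linear : ∀ {a y} → y * a ≈ 1# →
             θ (coeff (linear a)) ⊕ (coeff (linear a) ⊛ powers y) ≈ˢ S.0#
  θ-linear         ya≈1 zero    = trans (+-identityˡ _) (zeroʳ _)
  θ-linear {a} {y} ya≈1 (suc n) = begin
    suc n · coeff (C 1#) n +ᴷ ((0# +ᴷ - a) * (y * y ^ n) +ᴷ (coeff (C 1#) ⊛ powers y) n)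
      ≈⟨ +-congˡ (+-cong (trans (*-congʳ (+-identityˡ _)) -ay) (trans (S.⊛-cong {b = powers y} (coeff-C 1#) (λ _ → refl) n)
           (trans (S.const-⊛ 1# (powers y) n) (*-identityˡ _)))) ⟩
    suc n · coeff (C 1#) n +ᴷ (- (y ^ n) +ᴷ powers y n)
      ≈⟨ cancel n ⟩
    0# ∎
    where
    open K-Reasoning
    -ay : - a * (y * y ^ n) ≈ - (y ^ n)
    -ay = begin
      - a * (y * y ^ n)   ≈⟨ -‿distribˡ-* _ _ ⟨
      - (a * (y * y ^ n)) ≈⟨ -‿cong (*-assoc _ _ _) ⟨
      - (a * y * y ^ n)   ≈⟨ -‿cong (*-congʳ (trans (*-comm a y) ya≈1)) ⟩
      - (1# * y ^ n)      ≈⟨ -‿cong (*-identityˡ _) ⟩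
      - (y ^ n)           ∎
    cancel : ∀ n → suc n · coeff (C 1#) n +ᴷ (- (y ^ n) +ᴷ powers y n) ≈ 0#
    -- In degree 1 the term -y⁰ meets the coefficient 1 of θ X, as `powers y` starts with 0; in
    -- higher degrees the geometric terms cancel one another.
    cancel zero    = trans (+-cong (+-identityʳ _) (+-identityʳ _)) (-‿inverseʳ 1#)
    cancel (suc n) = trans (+-cong (n·0≈0 (suc (suc n))) (-‿inverseˡ _)) (+-identityˡ 0#)

  -- Logarithmic derivatives add, by the Leibniz rule.
  θ-product : ∀ {a b s t} → θ a ⊕ (a ⊛ s) ≈ˢ S.0# → θ b ⊕ (b ⊛ t) ≈ˢ S.0# →
              θ (a ⊛ b) ⊕ ((a ⊛ b) ⊛ (s ⊕ t)) ≈ˢ S.0#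
  θ-product {a} {b} {s} {t} p q = begin
    θ (a ⊛ b) ⊕ ((a ⊛ b) ⊛ (s ⊕ t))
      ≈⟨ S.+-congʳ {(a ⊛ b) ⊛ (s ⊕ t)} (S.θ-⊛ a b) ⟩
    ((θ a ⊛ b) ⊕ (a ⊛ θ b)) ⊕ ((a ⊛ b) ⊛ (s ⊕ t))
      ≈⟨ S.solve 6 (λ a b a′ b′ s t → (a′ S.:* b S.:+ a S.:* b′) S.:+ (a S.:* b) S.:* (s S.:+ t)
           S.:= (a′ S.:+ a S.:* s) S.:* b S.:+ a S.:* (b′ S.:+ b S.:* t)) S.refl a b (θ a) (θ b) s t ⟩
    ((θ a ⊕ (a ⊛ s)) ⊛ b) ⊕ (a ⊛ (θ b ⊕ (b ⊛ t)))
      ≈⟨ S.+-cong (S.*-congʳ {b} p) (S.*-congˡ {a} q) ⟩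
    (S.0# ⊛ b) ⊕ (a ⊛ S.0#)
      ≈⟨ S.+-cong (S.⊛-zeroˡ b) (S.zeroʳ a) ⟩
    S.0# ⊕ S.0#
      ≈⟨ S.+-identityʳ S.0# ⟩
    S.0# ∎
    where open S.Reasoning

  θ-C : ∀ k → θ (coeff (C k)) ⊕ (coeff (C k) ⊛ S.0#) ≈ˢ S.0#
  θ-C k n = trans (+-cong (trans (S.θ-cong (coeff-C k) n) (θ-const k n)) (S.zeroʳ (coeff (C k)) n)) (+-identityˡ 0#)

  θ-resp : ∀ {a b s} → a ≈ˢ b → θ b ⊕ (b ⊛ s) ≈ˢ S.0# → θ a ⊕ (a ⊛ s) ≈ˢ S.0#
  θ-resp {s = s} eq e = S.trans (S.+-cong (S.θ-cong eq) (S.*-congʳ {s} eq)) e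

  θ-roots : ∀ {d} (ϑ y : Vector Carrier d) → (∀ i → y i * ϑ i ≈ 1#) →
            θ (coeff (P.product (linear ∘ ϑ))) ⊕ (coeff (P.product (linear ∘ ϑ)) ⊛ powerSums y) ≈ˢ S.0#
  θ-roots {zero}  ϑ y yϑ≈1 = θ-C 1#
  θ-roots {suc d} ϑ y yϑ≈1 =
    θ-resp (coeff-* (linear (ϑ zero)) (P.product (linear ∘ ϑ ∘ suc)))
      (θ-product (θ-linear (yϑ≈1 zero)) (θ-roots (ϑ ∘ suc) (y ∘ suc) (yϑ≈1 ∘ suc)))

  module _ (δ d : ℕ) (ϑ : Vector Carrier d) (roots : AreRootsOf ϑ (p δ)) where

    L≈ : L δ ≈ˢ coeff (C (coeff (p δ) d)) ⊛ coeff (P.product (linear ∘ ϑ))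
    L≈ = S.trans (S.sym (p≈L δ)) (S.trans roots (coeff-* (C (coeff (p δ) d)) (P.product (linear ∘ ϑ))))

    ϑ#0 : ∀ i → ϑ i # 0#
    ϑ#0 = roots-nonzero ϑ (coeff (p δ) d) (trans (sym (L≈ 0)) (L₀≈1 δ))

    y : Vector Carrier d
    y i = inv (ϑ i) (ϑ#0 i)

    θL-roots : θ (L δ) ⊕ (L δ ⊛ powerSums y) ≈ˢ S.0#
    θL-roots = θ-resp L≈ (S.trans (S.+-congˡ {θ (_ ⊛ _)} (S.*-congˡ {_ ⊛ _} (λ n → sym (+-identityˡ _))))
      (θ-product (θ-C _) (θ-roots ϑ y (λ i → inv-inverseˡ (ϑ i) (ϑ#0 i)))))

    -- The factorisation and `θL` both evaluate -θ (L δ). Rewriting g δ as c₁ ⊛ L δ makes `L δ` a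
    -- common factor, which its constant term 1 allows to be cancelled.
    powerSums≈ : powerSums y ≈ˢ const (fromℕ (suc δ)) ⊛ (S.x ⊛ returnSeries δ 1)
    powerSums≈ = S.⊛-cancelˡ (L₀≈1 δ) (S.+-cancelʳ (θ (L δ)) _ _ (begin
      (L δ ⊛ powerSums y) ⊕ θ (L δ)
        ≈⟨ (λ n → +-comm _ _) ⟩
      θ (L δ) ⊕ (L δ ⊛ powerSums y)
        ≈⟨ θL-roots ⟩
      S.0#
        ≈⟨ θL δ ⟨
      θ (L δ) ⊕ ((suc δ S.· S.1#) ⊛ (S.x ⊛ g δ))
        ≈⟨ (λ n → +-comm _ _) ⟩
      ((suc δ S.· S.1#) ⊛ (S.x ⊛ g δ)) ⊕ θ (L δ)
        ≈⟨ S.+-congʳ {θ (L δ)} (S.⊛-cong (·1≈const (suc δ)) (S.*-congˡ {S.x} (S.sym (c₁*L δ)))) ⟩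
      (N ⊛ (S.x ⊛ (c₁ ⊛ L δ))) ⊕ θ (L δ)
        ≈⟨ S.+-congʳ {θ (L δ)} (S.solve 4 (λ n x c l → n S.:* (x S.:* (c S.:* l)) S.:= l S.:* (n S.:* (x S.:* c)))
             S.refl N S.x c₁ (L δ)) ⟩
      (L δ ⊛ (N ⊛ (S.x ⊛ c₁))) ⊕ θ (L δ) ∎))
      where
      open S.Reasoning
      N  = const (fromℕ (suc δ))
      c₁ = returnSeries δ 1

    powerSum : ∀ n → Σ (λ i → y i ^ suc n) ≈ fromℕ (suc δ) * fromℕ (returns δ 1 n)
    powerSum n = trans (powerSums≈ (suc n))
      (trans (S.const-⊛ (fromℕ (suc δ)) _ (suc n)) (*-congˡ (S.x-⊛-suc (returnSeries δ 1) n)))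

    ζ≈ : .{{_ : NonZero δ}} → ∀ m .{{_ : NonZero m}} →
         fromℕ (ζ m δ) ≈ (1/ suc δ) * Σ (λ i → y i ^ ⌊ m +ℕ 1 /2⌋)
    ζ≈ (suc m) = begin
      fromℕ (ζ (suc m) δ)
        ≡⟨ ≡.cong fromℕ (ζ≡returns m δ) ⟩
      r
        ≈⟨ trans (*-congʳ (inv-inverseˡ (fromℕ (suc δ)) (char0 (suc δ)))) (*-identityˡ r) ⟨
      1/ suc δ * fromℕ (suc δ) * r
        ≈⟨ *-assoc _ _ _ ⟩
      1/ suc δ * (fromℕ (suc δ) * r)
        ≈⟨ *-congˡ (powerSum ⌊ m /2⌋) ⟨
      1/ suc δ * Σ (λ i → y i ^ suc ⌊ m /2⌋)
        -- Here the size is m + 1, and `suc ⌊ m /2⌋` is `⌊ suc (suc m) /2⌋` by definition.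
        ≡⟨ ≡.cong (λ n → 1/ suc δ * Σ (λ i → y i ^ ⌊ suc n /2⌋)) (ℕ.+-comm 1 m) ⟩
      1/ suc δ * Σ (λ i → y i ^ ⌊ suc m +ℕ 1 /2⌋) ∎
      where
      open K-Reasoning
      r = fromℕ (returns δ 1 ⌊ m /2⌋)

theorem3 : ∀ {c ℓ₁ ℓ₂ : Level} (K : HeytingField c ℓ₁ ℓ₂) (char0 : CharacteristicZero K) →
    let open CharZeroField K char0 in
    ∀ (δ : ℕ) .{{_ : NonZero δ}}
    (d : ℕ) → HasDegree (p δ) d →
    ∀ (ϑ : Vector Carrier d) → AreRootsOf ϑ (p δ) →
    Σ[ ϑ#0 ∈ (∀ i → ϑ i # 0#) ]
    (∀ (m : ℕ) .{{_ : NonZero m}} →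
    fromℕ (ζ m δ) ≈ (1/ suc δ) * Σ (λ i → inv (ϑ i) (ϑ#0 i) ^ ⌊ m +ℕ 1 /2⌋))
theorem3 K char0 δ d _ ϑ roots = ϑ#0 δ d ϑ roots , ζ≈ δ d ϑ roots
  where open Roots K char0
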